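{- Let $\lambda$ be a strict partition with inner corner contents $x_0,\dots,x_m$ and outer corner contents $y_1,\dots,y_m$, let $0\le i\le m$, and let $\lambda^+=\lambda\cup\{\square\}$ be a strict partition obtained from $\lambda$ by adding one box $\square$ with $c_\square=x_i$. If $i=0$, then $$\frac{H_\lambda}{H_{\lambda^+}}=\frac{\prod_{1\le j\le m}\bigl(\binom{x_0}{2}-\binom{y_j}{2}\bigr)}{\prod_{1\le j\le m}\bigl(\binom{x_0}{2}-\binom{x_j}{2}\bigr)}.$$ If $1\le i\le m$, then $$\frac{H_\lambda}{H_{\lambda^+}}=\frac12\cdot\frac{\prod_{1\le j\le m}\bigl(\binom{x_i}{2}-\binom{y_j}{2}\bigr)}{\prod_{0\le j\le m,\ j\ne i}\bigl(\binom{x_i}{2}-\binom{x_j}{2}\bigr)}.$$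
   Context: A strict partition is a finite strictly decreasing sequence of positive integers $\lambda=(\lambda_1>\cdots>\lambda_\ell)$ (the empty sequence is allowed); $|\lambda|=\sum_i\lambda_i$, $\ell(\lambda)=\ell$, and $\lambda_i=0$ for $i>\ell(\lambda)$. The (shifted Young) diagram of $\lambda$ is the set of boxes $(i,j)$ with $1\le i\le\ell(\lambda)$, $i+1\le j\le i+\lambda_i$ (row $i$, column $j$); $\lambda$ is identified with its diagram. The content of $\square=(i,j)$ is $c_\square=j-i$. The hook length $h_\square$ of $\square=(i,j)\in\lambda$ is the number of boxes of $\lambda$ in row $i$ strictly to the right of $\square$, plus the number of boxes $(i',j)\in\lambda$ with $i'>i$, plus $1$, plus $\lambda_j$; $H_\lambda=\prod_{\square\in\lambda}h_\square$. Corners: an outer corner of $\lambda$ is a box of $\lambda$ whose removal leaves the diagram of a strict partition. Let $(\alpha_1,\beta_1),\dots,(\alpha_m,\beta_m)$ be the outer corners with $\alpha_1>\cdots>\alpha_m$, and $y_j=\beta_j-\alpha_j$ ($1\le j\le m$) their contents. Set $\alpha_{m+1}=0$, $\beta_0=\ell(\lambda)+1$, and $x_i=\beta_i-\alpha_{i+1}$ for $0\le i\le m$ (contents of the inner corners). One has $x_0=1\le y_1<x_1<y_2<\cdots<y_m<x_m$. -}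

module Defs where

open import Data.Nat.Base using (ℕ; zero; suc; _+_; _∸_; _>_; _<_; NonZero; >-nonZero)
open import Data.Nat.Properties using (_≟_; _<?_; m≤m+n; m≤n+m; ≤-trans)
open import Data.Nat.Combinatorics using (_C_)
open import Data.Nat.ListAction using (product)
open import Data.Nat.ListAction.Properties using (product≢0)
open import Data.Integer.Base using (+_)
open import Data.Rational.Base as ℚ using (ℚ)
open import Data.Rational.Properties using (*-1-commutativeMonoid)
open import Data.Fin.Base using (Fin)
open import Data.List.Base using (List; []; _∷_; length; map; concatMap; applyUpTo; filter)
open import Data.List.Membership.Propositional using (_∈_; _∉_)
open import Data.List.Relation.Unary.All as All using (All)
import Data.List.Relation.Unary.All.Properties as All
open import Data.List.Relation.Unary.Linked using (Linked)
open import Data.Vec.Base as Vec using (Vec; _∷ʳ_; lookup)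
import Data.Vec.Membership.Propositional as VecM
import Data.Vec.Relation.Unary.Linked as VecLinked
import Data.Vec.Relation.Unary.All as VecAll
open import Data.Product.Base using (_×_; _,_; proj₁; proj₂; ∃-syntax)
open import Data.Sum.Base using (_⊎_)
open import Function.Bundles using (_⇔_)
open import Relation.Binary.PropositionalEquality.Core using (_≡_; _≢_)
open import Relation.Nullary.Decidable using (_×-dec_)

open import Algebra.Properties.CommutativeMonoid.Sum *-1-commutativeMonoid public
  using () renaming (sum to ∏)

record StrictPartition : Set where
  field
    parts      : List ℕ
    decreasing : Linked _>_ parts
    positive   : All (0 <_) parts

open StrictPartition public

ℓ : StrictPartition → ℕ
ℓ μ = length (parts μ)

-- 1-indexed, and 0 beyond the end; index 0 is never used and gets the
-- junk value 0.
nth : List ℕ → ℕ → ℕ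
nth []       _             = 0
nth (p ∷ ps) zero          = 0
nth (p ∷ ps) (suc zero)    = p
nth (p ∷ ps) (suc (suc i)) = nth ps (suc i)

part : StrictPartition → ℕ → ℕ
part μ = nth (parts μ)

Box : Set
Box = ℕ × ℕ

row col : Box → ℕ
row = proj₁
col = proj₂

-- Boxes lie strictly above the main diagonal (row < col), so the
-- truncated subtraction is exact.
content : Box → ℕ
content b = col b ∸ row b

-- The diagram {(i , j) ∣ 1 ≤ i ≤ ℓ μ, i + 1 ≤ j ≤ i + part μ i}, each box
-- listed once: (i , i + c) for c = 1, …, part μ i.
boxes : StrictPartition → List Box
boxes μ = concatMap (λ i → applyUpTo (λ k → i , i + suc k) (part μ i))
                    (applyUpTo suc (ℓ μ))

arm leg : StrictPartition → Box → ℕ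
arm μ b = length (filter (λ c → (row c ≟ row b) ×-dec (col b <? col c)) (boxes μ))
leg μ b = length (filter (λ c → (col c ≟ col b) ×-dec (row b <? row c)) (boxes μ))

hook : StrictPartition → Box → ℕ
hook μ b = arm μ b + leg μ b + 1 + part μ (col b)

H : StrictPartition → ℕ
H μ = product (map (hook μ) (boxes μ))

H≢0 : ∀ μ → NonZero (H μ)
H≢0 μ = product≢0 (All.map⁺ (All.universal hook≢0 (boxes μ)))
  where
  hook≢0 : ∀ b → NonZero (hook μ b)
  hook≢0 b = >-nonZero (≤-trans (m≤n+m 1 (arm μ b + leg μ b)) (m≤m+n _ _))

-- The diagram of μ⁺ is that of μ together with the new box b.
IsAddition : StrictPartition → Box → StrictPartition → Set
IsAddition μ b μ⁺ = b ∉ boxes μ × (∀ c → c ∈ boxes μ⁺ ⇔ (c ∈ boxes μ ⊎ c ≡ b))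

IsOuterCorner : StrictPartition → Box → Set
IsOuterCorner μ b =
  b ∈ boxes μ × ∃[ ν ] (∀ c → c ∈ boxes ν ⇔ (c ∈ boxes μ × c ≢ b))

-- The vector (α₁ , β₁), …, (αₘ , βₘ) lists exactly the outer corners,
-- with α₁ > ⋯ > αₘ.  For each μ this determines m and the vector.
record IsOuterCorners (μ : StrictPartition) {m} (corners : Vec Box m) : Set where
  field
    rows-decreasing : VecLinked.Linked (λ b c → row b > row c) corners
    sound           : VecAll.All (IsOuterCorner μ) corners
    complete        : ∀ b → IsOuterCorner μ b → b VecM.∈ corners

-- y corners is indexed from 0: its value at k is the content of the
-- corner (αₖ₊₁ , βₖ₊₁).
y : ∀ {m} → Vec Box m → Fin m → ℕ
y corners j = content (lookup corners j)

-- xᵢ = βᵢ − αᵢ₊₁ for 0 ≤ i ≤ m, where β₀ = ℓ μ + 1 and αₘ₊₁ = 0.  Since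
-- αᵢ₊₁ < βᵢ when corners lists the outer corners of μ, the truncated
-- subtraction is exact.
x : ∀ (μ : StrictPartition) {m} → Vec Box m → Fin (suc m) → ℕ
x μ corners i = lookup (suc (ℓ μ) Vec.∷ Vec.map col corners) i
              ∸ lookup (Vec.map row corners ∷ʳ 0) i

binom₂ : ℕ → ℚ
binom₂ n = + (n C 2) ℚ./ 1

H-ratio : StrictPartition → StrictPartition → ℚ
H-ratio μ ν = (+ H μ ℚ./ H ν) {{H≢0 ν}}

{-# OPTIONS --safe #-}
-- Let p be the first part and ps the remaining ones.  The product R of the hooks in the first
-- row satisfies R ∏ (p − q) = p! ∏ (p + q), the products being over q ∈ ps.  If □ turns the
-- part a into a + 1, then comparing the rows gives H_λ / H_λ⁺ as 1 / (a + 1) times the product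
-- over the parts b ≠ a of (a + b)(a + 1 − b) / ((a + b + 1)(a − b)) = f(b) / f(b + 1), where
-- f(n) = C(a + 1, 2) − C(n, 2).  This product telescopes along the maximal runs of consecutive
-- parts: a run contributes f(y) / f(x), where y is its least part and x − 1 its largest one.
-- The run ending in a lacks the factor for b = a and contributes f(y) / f(a) = f(y) / a, and
-- 1 / (a (a + 1)) = ½ / f(1).  Appending a part 1 is the case a = 0.
module Submission where

open import Defs
open import Data.Nat.Base as ℕ using (ℕ; zero; suc; _∸_; _≤_; _<_; _>_; z≤n; s≤s; z<s; s<s; _!)
import Data.Nat.Properties as ℕ
open import Data.Nat.Combinatorics using (_C_; nC1≡n; nCk+nC[k+1]≡[n+1]C[k+1])
open import Data.Nat.ListAction using (product)
open import Data.Nat.ListAction.Properties using (product-++; product≢0)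
import Data.Nat.Solver as ℕ
open import Data.List.Base using (List; []; _∷_; _++_; length; map; concatMap; applyUpTo; filter; foldr)
open import Data.List.Properties
  using (map-applyUpTo; map-++; map-∘; map-cong-local; applyUpTo-∷ʳ; length-applyUpTo; length-++;
         filter-++; filter-all; filter-none; filter-accept; filter-reject)
open import Data.List.Relation.Unary.All as All using (All; []; _∷_)
import Data.List.Relation.Unary.All.Properties as All
open import Data.List.Relation.Unary.AllPairs as AllPairs using ()
open import Data.List.Relation.Unary.Any using (here; there)
open import Data.List.Relation.Unary.Linked as Linked using (Linked; []; [-]; _∷_)
open import Data.List.Relation.Unary.Linked.Properties using (Linked⇒AllPairs)
open import Data.List.Membership.Propositional using (_∈_; find; lose)
open import Data.List.Membership.Propositional.Properties
  using (∈-applyUpTo⁺; ∈-applyUpTo⁻; ∈-concatMap⁺; ∈-concatMap⁻)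
open import Data.Vec.Base as Vec using (Vec; []; _∷_; _∷ʳ_; lookup)
open import Data.Vec.Functional using (removeAt)
import Data.Vec.Membership.Propositional as VecM
import Data.Vec.Relation.Unary.Any as VecAny
import Data.Vec.Relation.Unary.Linked as VecLinked
import Data.Vec.Relation.Unary.Linked.Properties as VecLinked
import Data.Vec.Relation.Unary.All as VecAll
open import Data.Product.Base using (_×_; _,_; proj₁; proj₂; ∃-syntax; Σ-syntax)
open import Data.Sum.Base using (_⊎_; inj₁; inj₂)
open import Function.Base using (_∘_; id)
open import Function.Bundles using (mk⇔; Equivalence)
open import Level using (0ℓ)
open import Relation.Binary.Definitions using (tri<; tri≈; tri>)
open import Relation.Binary.PropositionalEquality
  using (_≡_; _≢_; refl; sym; trans; cong; cong₂; subst; subst₂; module ≡-Reasoning)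
open import Relation.Nullary using (yes; no; ¬_; contradiction; Dec)
open import Relation.Nullary.Decidable using (_×-dec_; _→-dec_)
open import Relation.Unary using (Pred; Decidable)
open ≡-Reasoning

-- The factor f(b + 1) at b = a and the factor f(xᵢ) are both f(a + 1) = 0, so the quotients cannot
-- be formed as they stand. The function `g`, equal to 1 at this single point and to f elsewhere,
-- drops both factors together. Every identity stays cross-multiplied until one final division;
-- nonvanishing of `g` at positive integers and distinctness of the inner contents make the
-- denominators nonzero. Corners are read from the last row upwards: in that order the parts
-- increase along each run, and the telescoping carries a single pending factor.

module Diagrams where

  open import Data.Nat.Base using (_+_; _*_; NonZero; >-nonZero)
  open import Data.Nat.Properties
  open import Data.Nat.Solver using (module +-*-Solver)

  -- Finite products and counting.

  ∏< : (ℕ → ℕ) → ℕ → ℕ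
  ∏< f n = product (applyUpTo f n)

  ∏<-suc : ∀ f n → ∏< f (suc n) ≡ ∏< f n * f n
  ∏<-suc f n = begin
    product (applyUpTo f (suc n))         ≡⟨ cong product (applyUpTo-∷ʳ f n) ⟨
    product (applyUpTo f n ++ (f n ∷ []))    ≡⟨ product-++ (applyUpTo f n) (f n ∷ []) ⟩
    ∏< f n * (f n * 1)                    ≡⟨ cong (∏< f n *_) (*-identityʳ (f n)) ⟩
    ∏< f n * f n                          ∎

  ∏<-cong : ∀ {f g} n → (∀ k → k < n → f k ≡ g k) → ∏< f n ≡ ∏< g n
  ∏<-cong zero    _ = refl
  ∏<-cong (suc n) h = cong₂ _*_ (h 0 z<s) (∏<-cong n (λ k k<n → h (suc k) (s<s k<n)))

  suc-∸-suc : ∀ {m n} → m < n → suc (n ∸ suc m) ≡ n ∸ m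
  suc-∸-suc {m} {n} m<n = sym (+-∸-assoc 1 m<n)

  -- The factors with m ≤ k < m + d form the falling factorial (p - m)! / (p - m - d)!, here with
  -- its denominator cleared.
  ∏<-falling : ∀ f p m d → m + d ≤ p → (∀ k → m ≤ k → k < m + d → f k ≡ p ∸ k) →
               ∏< f (m + d) * (p ∸ (m + d)) ! ≡ ∏< f m * (p ∸ m) !
  ∏<-falling f p m zero    _ _ = cong (λ n → ∏< f n * (p ∸ n) !) (+-identityʳ m)
  ∏<-falling f p m (suc d) h eq rewrite +-suc m d = begin
    ∏< f (suc n) * r !       ≡⟨ cong (_* r !) (∏<-suc f n) ⟩
    ∏< f n * f n * r !       ≡⟨ *-assoc (∏< f n) (f n) (r !) ⟩
    ∏< f n * (f n * r !)
      ≡⟨ cong (λ z → ∏< f n * (z * r !)) (trans (eq n (m≤m+n m d) ≤-refl) (sym (suc-∸-suc h))) ⟩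
    ∏< f n * (suc r) !       ≡⟨ cong (λ z → ∏< f n * z !) (suc-∸-suc h) ⟩
    ∏< f n * (p ∸ n) !
      ≡⟨ ∏<-falling f p m d (≤-trans (n≤1+n n) h) (λ k m≤k k<n → eq k m≤k (m≤n⇒m≤1+n k<n)) ⟩
    ∏< f m * (p ∸ m) !       ∎
    where
    n = m + d
    r = p ∸ suc n

  private variable
    A B : Set

  count : {P : Pred A 0ℓ} → Decidable P → List A → ℕ
  count P? xs = length (filter P? xs)

  count-++ : ∀ {P : Pred A 0ℓ} (P? : Decidable P) xs ys → count P? (xs ++ ys) ≡ count P? xs + count P? ys
  count-++ P? xs ys = trans (cong length (filter-++ P? xs ys)) (length-++ (filter P? xs))

  count-none : ∀ {P : Pred A 0ℓ} (P? : Decidable P) {xs} → All (¬_ ∘ P) xs → count P? xs ≡ 0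
  count-none P? h = cong length (filter-none P? h)

  count-map : ∀ {P : Pred A 0ℓ} {Q : Pred B 0ℓ} (P? : Decidable P) (Q? : Decidable Q) (f : A → B) {xs} →
              All (λ x → (Q (f x) → P x) × (P x → Q (f x))) xs → count Q? (map f xs) ≡ count P? xs
  count-map P? Q? f [] = refl
  count-map P? Q? f {x ∷ xs} ((to , from) ∷ h) with P? x
  ... | yes px = trans (cong length (filter-accept Q? (from px))) (cong suc (count-map P? Q? f h))
  ... | no ¬px = trans (cong length (filter-reject Q? (¬px ∘ to))) (count-map P? Q? f h)

  count-> : ∀ {P : Pred A 0ℓ} (P? : Decidable P) (f : ℕ → A) k n → (∀ t → (P (f t) → k < t) × (k < t → P (f t))) →
            count P? (applyUpTo f n) ≡ n ∸ suc k
  count-> P? f k       zero    h = refl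
  count-> P? f zero    (suc n) h = begin
    count P? (f 0 ∷ applyUpTo (f ∘ suc) n) ≡⟨ cong length (filter-reject P? (n≮0 ∘ proj₁ (h 0))) ⟩
    count P? (applyUpTo (f ∘ suc) n)
      ≡⟨ cong length (filter-all P? (All.applyUpTo⁺₂ (f ∘ suc) n (λ t → proj₂ (h (suc t)) z<s))) ⟩
    length (applyUpTo (f ∘ suc) n)         ≡⟨ length-applyUpTo (f ∘ suc) n ⟩
    n                                      ∎
  count-> P? f (suc k) (suc n) h = trans
    (cong length (filter-reject P? (n≮0 ∘ proj₁ (h 0))))
    (count-> P? (f ∘ suc) k n (λ t → ≤-pred ∘ proj₁ (h (suc t)) , proj₂ (h (suc t)) ∘ s<s))

  count-≡-< : ∀ {P : Pred A 0ℓ} (P? : Decidable P) (f : ℕ → A) {k n} → (∀ t → (P (f t) → t ≡ k) × (t ≡ k → P (f t))) →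
              k < n → count P? (applyUpTo f n) ≡ 1
  count-≡-< P? f {zero}  {suc n} h _ = trans
    (cong length (filter-accept P? (proj₂ (h 0) refl)))
    (cong suc (count-none P? (All.applyUpTo⁺₂ (f ∘ suc) n (λ t → 1+n≢0 ∘ proj₁ (h (suc t))))))
  count-≡-< P? f {suc k} {suc n} h (s<s k<n) = trans
    (cong length (filter-reject P? (0≢1+n ∘ proj₁ (h 0))))
    (count-≡-< P? (f ∘ suc) (λ t → suc-injective ∘ proj₁ (h (suc t)) , proj₂ (h (suc t)) ∘ cong suc) k<n)

  count-≡-≥ : ∀ {P : Pred A 0ℓ} (P? : Decidable P) (f : ℕ → A) {k n} → (∀ t → (P (f t) → t ≡ k) × (t ≡ k → P (f t))) →
              n ≤ k → count P? (applyUpTo f n) ≡ 0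
  count-≡-≥ P? f {k} {n} h n≤k = count-none P? (All.applyUpTo⁺₁ f n
    (λ {t} t<n → λ p → <-irrefl (proj₁ (h t) p) (<-≤-trans t<n n≤k)))

  -- Diagrams and hook lengths by recursion on the rows.

  rowBoxes : List ℕ → ℕ → List Box
  rowBoxes ps i = applyUpTo (λ k → i , i + suc k) (nth ps i)

  diagram : List ℕ → List Box
  diagram ps = concatMap (rowBoxes ps) (applyUpTo suc (length ps))

  -- On bare lists an induction can pass to the tail without carrying proofs of strictness and
  -- positivity; at `parts μ` these unfold to `arm`, `leg` and `hook`.
  armᴸ legᴸ hookᴸ : List ℕ → Box → ℕ
  armᴸ ps b = count (λ c → (row c ≟ row b) ×-dec (col b <? col c)) (diagram ps)
  legᴸ ps b = count (λ c → (col c ≟ col b) ×-dec (row b <? row c)) (diagram ps)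
  hookᴸ ps b = armᴸ ps b + legᴸ ps b + 1 + nth ps (col b)

  Hᴸ : List ℕ → ℕ
  Hᴸ ps = product (map (hookᴸ ps) (diagram ps))

  shift : Box → Box
  shift (i , j) = suc i , suc j

  firstRow : ℕ → List Box
  firstRow p = applyUpTo (λ k → 1 , 2 + k) p

  -- Each row starts one column to the right of the row above it, so the rows below the first are
  -- the diagram of `ps` moved diagonally.
  diagram-∷ : ∀ p ps → diagram (p ∷ ps) ≡ firstRow p ++ map shift (diagram ps)
  diagram-∷ p ps = cong (firstRow p ++_) (lower id (length ps))
    where
    lower : ∀ h n → concatMap (rowBoxes (p ∷ ps)) (applyUpTo (suc ∘ suc ∘ h) n)
                  ≡ map shift (concatMap (rowBoxes ps) (applyUpTo (suc ∘ h) n))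
    lower h zero    = refl
    lower h (suc n) = trans
      (cong₂ _++_ (sym (map-applyUpTo _ shift (nth ps (suc (h 0))))) (lower (h ∘ suc) n))
      (sym (map-++ shift (rowBoxes ps (suc (h 0))) _))

  Positive : Box → Set
  Positive b = 0 < row b × 0 < col b

  diagram-positive : ∀ ps → All Positive (diagram ps)
  diagram-positive []       = []
  diagram-positive (p ∷ ps) = subst (All Positive) (sym (diagram-∷ p ps))
    (All.++⁺ (All.applyUpTo⁺₂ _ p (λ _ → z<s , z<s)) (All.map⁺ (All.universal (λ _ → z<s , z<s) (diagram ps))))

  -- legᴸ ps (0 , j) counts the boxes of column j.
  offset : List ℕ → ℕ → ℕ
  offset ps k = legᴸ ps (0 , suc k) + nth ps (suc k)

  shift-≡-< : ∀ {i i′ j j′} → (suc i ≡ suc i′ × suc j < suc j′ → i ≡ i′ × j < j′) ×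
                              (i ≡ i′ × j < j′ → suc i ≡ suc i′ × suc j < suc j′)
  shift-≡-< = (λ where (eq , lt) → suc-injective eq , ≤-pred lt) ,
              (λ where (eq , lt) → cong suc eq , s<s lt)

  module _ (p : ℕ) (ps : List ℕ) where

    count-∷ : ∀ {P : Pred Box 0ℓ} (P? : Decidable P) →
              count P? (diagram (p ∷ ps)) ≡ count P? (firstRow p) + count P? (map shift (diagram ps))
    count-∷ P? = trans (cong (count P?) (diagram-∷ p ps)) (count-++ P? (firstRow p) _)

    -- A positive row keeps the first row out of the arm, and the leg looks only downwards. A
    -- positive column keeps the extra part the same, the column and the index into the list both
    -- moving by one.
    hook-shift : ∀ {b} → Positive b → hookᴸ (p ∷ ps) (shift b) ≡ hookᴸ ps b
    hook-shift {i , suc j} (0<i , _) = cong₂ (λ a l → a + l + 1 + nth ps (suc j))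
      (trans (count-∷ _) (cong₂ _+_
        (count-none _ (All.applyUpTo⁺₂ _ p (λ _ → λ where (eq , _) → <⇒≢ 0<i (suc-injective eq))))
        (count-map _ _ shift (All.universal (λ _ → shift-≡-<) (diagram ps)))))
      (trans (count-∷ _) (cong₂ _+_
        (count-none _ (All.applyUpTo⁺₂ _ p (λ _ → λ where (_ , lt) → n≮0 (≤-pred lt))))
        (count-map _ _ shift (All.universal (λ _ → shift-≡-<) (diagram ps)))))

    hook-firstRow : ∀ k → hookᴸ (p ∷ ps) (1 , 2 + k) ≡ suc (p ∸ suc k) + offset ps k
    hook-firstRow k = begin
      hookᴸ (p ∷ ps) (1 , 2 + k)
        ≡⟨ cong₂ (λ a l → a + l + 1 + nth ps (suc k)) arm≡ leg≡ ⟩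
      (p ∸ suc k) + legᴸ ps (0 , suc k) + 1 + nth ps (suc k)
        ≡⟨ solve 3 (λ a l n → a :+ l :+ con 1 :+ n := con 1 :+ a :+ (l :+ n))
           refl (p ∸ suc k) (legᴸ ps (0 , suc k)) (nth ps (suc k)) ⟩
      suc (p ∸ suc k) + offset ps k                           ∎
      where
      open +-*-Solver
      arm≡ : armᴸ (p ∷ ps) (1 , 2 + k) ≡ p ∸ suc k
      arm≡ = trans (count-∷ _) (trans (cong₂ _+_
        (count-> _ _ k p (λ t → (λ where (_ , lt) → ≤-pred (≤-pred lt)) , λ lt → refl , s<s (s<s lt)))
        (count-none _ (All.map⁺
          (All.map (λ where (0<i , _) (eq , _) → <⇒≢ 0<i (sym (suc-injective eq))) (diagram-positive ps)))))
        (+-identityʳ _))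
      leg≡ : legᴸ (p ∷ ps) (1 , 2 + k) ≡ legᴸ ps (0 , suc k)
      leg≡ = trans (count-∷ _) (cong₂ _+_
        (count-none _ (All.applyUpTo⁺₂ _ p (λ _ → λ where (_ , lt) → n≮0 (≤-pred lt))))
        (count-map _ _ shift (All.universal (λ _ → shift-≡-<) (diagram ps))))

  -- The product of the hooks in the first row.

  rowHooks : ℕ → List ℕ → ℕ
  rowHooks p ps = ∏< (λ k → suc (p ∸ suc k) + offset ps k) p

  Hᴸ-∷ : ∀ p ps → Hᴸ (p ∷ ps) ≡ rowHooks p ps * Hᴸ ps
  Hᴸ-∷ p ps = begin
    product (map h (diagram (p ∷ ps)))
      ≡⟨ cong (product ∘ map h) (diagram-∷ p ps) ⟩
    product (map h (firstRow p ++ map shift (diagram ps)))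
      ≡⟨ cong product (map-++ h (firstRow p) _) ⟩
    product (map h (firstRow p) ++ map h (map shift (diagram ps)))  ≡⟨ product-++ (map h (firstRow p)) _ ⟩
    product (map h (firstRow p)) * product (map h (map shift (diagram ps)))
      ≡⟨ cong₂ (λ xs ys → product xs * product ys) (map-applyUpTo _ h p)
           (trans (sym (map-∘ (diagram ps))) (map-cong-local (All.map (hook-shift p ps) (diagram-positive ps)))) ⟩
    ∏< (λ k → h (1 , 2 + k)) p * Hᴸ ps
      ≡⟨ cong (_* Hᴸ ps) (∏<-cong p (λ k _ → hook-firstRow p ps k)) ⟩
    rowHooks p ps * Hᴸ ps                                           ∎
    where h = hookᴸ (p ∷ ps)

  -- No box lies in column 1, so only the extra part contributes.
  offset-0 : ∀ q qs → offset (q ∷ qs) 0 ≡ q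
  offset-0 q qs = cong (_+ q) (count-none _ (subst (All _) (sym (diagram-∷ q qs)) (All.++⁺
    (All.applyUpTo⁺₂ _ q (λ _ ()))
    (All.map⁺ (All.map (λ where (_ , 0<j) (eq , _) → <⇒≢ 0<j (sym (suc-injective eq))) (diagram-positive qs))))))

  module _ (q : ℕ) (qs : List ℕ) {k : ℕ} where

    private
      lower : count (λ c → (col c ≟ suc (suc k)) ×-dec (0 <? row c)) (map shift (diagram qs)) ≡ legᴸ qs (0 , suc k)
      lower = count-map _ _ shift (All.map
        (λ where (0<i , _) → (λ where (eq , _) → suc-injective eq , 0<i) , λ where (eq , _) → cong suc eq , z<s)
        (diagram-positive qs))

      same-column : ∀ t → (suc (suc t) ≡ suc (suc k) × 0 < 1 → t ≡ k) × (t ≡ k → suc (suc t) ≡ suc (suc k) × 0 < 1)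
      same-column t = (λ where (refl , _) → refl) , λ where refl → refl , z<s

    -- The row of length q occupies the columns 2 to q + 1, hence column k + 2 exactly when k < q.
    offset-< : k < q → offset (q ∷ qs) (suc k) ≡ suc (offset qs k)
    offset-< k<q = cong (_+ nth qs (suc k)) (trans (count-∷ q qs _) (cong₂ _+_ (count-≡-< _ _ same-column k<q) lower))

    offset-≥ : q ≤ k → offset (q ∷ qs) (suc k) ≡ offset qs k
    offset-≥ q≤k = cong (_+ nth qs (suc k)) (trans (count-∷ q qs _) (cong₂ _+_ (count-≡-≥ _ _ same-column q≤k) lower))

  -- Strict decrease below q confines the diagram of `qs` to the columns up to q and leaves it at
  -- most q parts, so the column count and the extra part both vanish.
  offset-beyond : ∀ q qs {k} → Linked _>_ (q ∷ qs) → q ≤ k → offset qs k ≡ 0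
  offset-beyond q []        _             _             = refl
  offset-beyond q (q′ ∷ qs) {zero}  (q>q′ ∷ _)  z≤n = contradiction q>q′ n≮0
  offset-beyond q (q′ ∷ qs) {suc k} (q>q′ ∷ dec) q≤k = trans (offset-≥ q′ qs q′≤k) (offset-beyond q′ qs dec q′≤k)
    where q′≤k = ≤-pred (≤-trans q>q′ q≤k)

  -- The generalisation from N = p to N ≤ p makes the induction on qs go through:
  -- beyond column q the hooks of the row are consecutive integers.
  partialRow : ∀ p N qs → Linked _>_ (N ∷ qs) → N ≤ p →
               ∏< (λ k → suc (p ∸ suc k) + offset qs k) N * product (map (p ∸_) qs) * (p ∸ N) !
               ≡ p ! * product (map (p +_) qs)
  partialRow p N [] _ N≤p = begin
    ∏< f N * 1 * (p ∸ N) !    ≡⟨ cong (_* (p ∸ N) !) (*-identityʳ (∏< f N)) ⟩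
    ∏< f N * (p ∸ N) !
      ≡⟨ ∏<-falling f p 0 N N≤p (λ k _ k<N → trans (+-identityʳ _) (suc-∸-suc (<-≤-trans k<N N≤p))) ⟩
    1 * p !                   ≡⟨ *-comm 1 (p !) ⟩
    p ! * 1                   ∎
    where f = λ k → suc (p ∸ suc k) + 0
  partialRow (suc p) (suc N) (q ∷ qs) (s≤s q≤N ∷ dec) (s≤s N≤p) = begin
    f 0 * ∏< g N * (r * Πd) * (p ∸ N) !
      ≡⟨ cong (λ z → z * ∏< g N * (r * Πd) * (p ∸ N) !) (cong (suc p +_) (offset-0 q qs)) ⟩
    s * ∏< g N * (r * Πd) * (p ∸ N) !
      ≡⟨ solve 5 (λ s P r d t → s :* P :* (r :* d) :* t := s :* ((P :* t) :* (r :* d)))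
         refl s (∏< g N) r Πd ((p ∸ N) !) ⟩
    s * (∏< g N * (p ∸ N) ! * (r * Πd))      ≡⟨ cong (λ z → s * (z * (r * Πd))) falling ⟩
    s * (∏< g q * (p ∸ q) ! * (r * Πd))
      ≡⟨ cong (λ z → s * (z * (p ∸ q) ! * (r * Πd))) (∏<-cong q g≡h) ⟩
    s * (∏< h q * (p ∸ q) ! * (r * Πd))
      ≡⟨ solve 5 (λ s P t r d → s :* (P :* t :* (r :* d)) := s :* (P :* d :* (r :* t)))
         refl s (∏< h q) ((p ∸ q) !) r Πd ⟩
    s * (∏< h q * Πd * (r * (p ∸ q) !))      ≡⟨ cong (λ z → s * (∏< h q * Πd * z)) r! ⟩
    s * (∏< h q * Πd * (suc p ∸ q) !)        ≡⟨ cong (s *_) (partialRow (suc p) q qs dec (m≤n⇒m≤1+n q≤p)) ⟩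
    s * ((suc p) ! * Πs)
      ≡⟨ solve 3 (λ s t P → s :* (t :* P) := t :* (s :* P)) refl s ((suc p) !) Πs ⟩
    (suc p) ! * (s * Πs)                     ∎
    where
    open +-*-Solver
    f = λ k → suc (suc p ∸ suc k) + offset (q ∷ qs) k
    g = λ k → suc (p ∸ suc k) + offset (q ∷ qs) (suc k)
    h = λ k → suc (p ∸ k) + offset qs k
    s = suc p + q
    r = suc p ∸ q
    Πd = product (map (suc p ∸_) qs)
    Πs = product (map (suc p +_) qs)
    q≤p = ≤-trans q≤N N≤p

    -- The first of the differences is the factor that raises (p - q)! to the factorial required by
    -- the induction hypothesis with N = q.
    r! : r * (p ∸ q) ! ≡ (suc p ∸ q) !
    r! = subst (λ z → z * (p ∸ q) ! ≡ z !) (suc-∸-suc (s≤s q≤p)) refl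

    -- Moving one column to the right shortens the arm by one, while the box of row q in that column
    -- lengthens the leg by one.
    g≡h : ∀ k → k < q → g k ≡ h k
    g≡h k k<q = begin
      suc (p ∸ suc k) + offset (q ∷ qs) (suc k)
        ≡⟨ cong₂ _+_ (suc-∸-suc (<-≤-trans k<q q≤p)) (offset-< q qs k<q) ⟩
      (p ∸ k) + suc (offset qs k)               ≡⟨ +-suc _ _ ⟩
      suc (p ∸ k) + offset qs k                 ∎

    -- Past the end of row q there is no leg and no extra part, so the hooks run through p - q, ...,
    -- p - N + 1.
    falling : ∏< g N * (p ∸ N) ! ≡ ∏< g q * (p ∸ q) !
    falling = subst (λ n → ∏< g n * (p ∸ n) ! ≡ ∏< g q * (p ∸ q) !) (m+[n∸m]≡n q≤N)
      (∏<-falling g p q (N ∸ q) (subst (_≤ p) (sym (m+[n∸m]≡n q≤N)) N≤p) λ k q≤k k<n → begin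
        suc (p ∸ suc k) + offset (q ∷ qs) (suc k) ≡⟨ cong₂ _+_
          (suc-∸-suc (<-≤-trans (subst (k <_) (m+[n∸m]≡n q≤N) k<n) N≤p))
          (trans (offset-≥ q qs q≤k) (offset-beyond q qs dec q≤k)) ⟩
        (p ∸ k) + 0                               ≡⟨ +-identityʳ _ ⟩
        p ∸ k                                     ∎)

  rowHooks-formula : ∀ p ps → Linked _>_ (p ∷ ps) →
                     rowHooks p ps * product (map (p ∸_) ps) ≡ p ! * product (map (p +_) ps)
  rowHooks-formula p ps dec = begin
    rowHooks p ps * product (map (p ∸_) ps)             ≡⟨ *-identityʳ _ ⟨
    rowHooks p ps * product (map (p ∸_) ps) * 0 !
      ≡⟨ cong (λ z → rowHooks p ps * product (map (p ∸_) ps) * z !) (n∸n≡0 p) ⟨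
    rowHooks p ps * product (map (p ∸_) ps) * (p ∸ p) ! ≡⟨ partialRow p p ps dec ≤-refl ⟩
    p ! * product (map (p +_) ps)                       ∎

  -- Adding a box as growing one part.

  ∈-diagram⁻ : ∀ ps {b} → b ∈ diagram ps → 0 < row b × row b < col b × col b ≤ row b + nth ps (row b)
  ∈-diagram⁻ ps b∈ with find (∈-concatMap⁻ (rowBoxes ps) {xs = applyUpTo suc (length ps)} b∈)
  ... | i , i∈ , b∈i with ∈-applyUpTo⁻ suc i∈ | ∈-applyUpTo⁻ _ b∈i
  ... | _ , _ , refl | k , k<p , refl = z<s , m<m+n i z<s , +-monoʳ-≤ i k<p

  nth-beyond : ∀ ps {i} → length ps ≤ i → nth ps (suc i) ≡ 0
  nth-beyond []       _         = refl
  nth-beyond (p ∷ ps) (s≤s l≤i) = nth-beyond ps l≤i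

  nth>0⇒<length : ∀ ps {i} → 0 < nth ps (suc i) → i < length ps
  nth>0⇒<length ps {i} h = ≰⇒> λ l≤i → n≮0 (subst (0 <_) (nth-beyond ps l≤i) h)

  nth-positive : ∀ {ps i} → All (0 <_) ps → i < length ps → 0 < nth ps (suc i)
  nth-positive {i = zero}  (0<p ∷ _)   _         = 0<p
  nth-positive {i = suc i} (_ ∷ 0<ps) (s≤s i<l) = nth-positive 0<ps i<l

  ∈-diagram⁺ : ∀ ps {i j} → 0 < i → i < j → j ≤ i + nth ps i → (i , j) ∈ diagram ps
  ∈-diagram⁺ ps {suc i} {j} _ i<j j≤ = ∈-concatMap⁺ (rowBoxes ps) (lose
    (∈-applyUpTo⁺ suc (nth>0⇒<length ps
      (+-cancelˡ-< (suc i) _ _ (subst (_< suc i + p) (sym (+-identityʳ _)) (<-≤-trans i<j j≤)))))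
    (subst (λ z → (suc i , z) ∈ rowBoxes ps (suc i)) j≡
      (∈-applyUpTo⁺ _ (+-cancelˡ-≤ (suc i) _ _ (subst (_≤ suc i + p) (sym j≡) j≤)))))
    where
    p = nth ps (suc i)
    j≡ : suc i + suc (j ∸ suc (suc i)) ≡ j
    j≡ = trans (+-suc (suc i) _) (m+[n∸m]≡n i<j)

  nth-suc-≤ : ∀ {ps} i → Linked _>_ ps → nth ps (suc (suc i)) ≤ nth ps (suc i)
  nth-suc-≤ i       []          = z≤n
  nth-suc-≤ zero    [-]         = z≤n
  nth-suc-≤ (suc i) [-]         = z≤n
  nth-suc-≤ zero    (p>q ∷ _)   = <⇒≤ p>q
  nth-suc-≤ (suc i) (_ ∷ dec)   = nth-suc-≤ i dec

  nth-suc-< : ∀ {ps} i → Linked _>_ ps → 0 < nth ps (suc i) → nth ps (suc (suc i)) < nth ps (suc i)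
  nth-suc-< zero    [-]       0<p = 0<p
  nth-suc-< zero    (p>q ∷ _) _   = p>q
  nth-suc-< (suc i) (_ ∷ dec) h   = nth-suc-< i dec h

  nth-antitone : ∀ {ps} i d → Linked _>_ ps → nth ps (suc (d + i)) ≤ nth ps (suc i)
  nth-antitone i zero    dec = ≤-refl
  nth-antitone i (suc d) dec = ≤-trans (nth-suc-≤ (d + i) dec) (nth-antitone i d dec)

  nth-strict : ∀ {ps i j} → Linked _>_ ps → All (0 <_) ps → i < j → j ≤ length ps → nth ps (suc j) < nth ps (suc i)
  nth-strict {ps} {i} {j} dec 0<ps i<j j≤l =
    subst (λ z → nth ps (suc z) < nth ps (suc i)) (m∸n+n≡m i<j)
      (≤-<-trans (nth-antitone (suc i) (j ∸ suc i) dec) (nth-suc-< i dec (nth-positive 0<ps (<-≤-trans i<j j≤l))))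

  -- The bounds admit the row just past the end, whose part is 0. This is what will separate x₀ from
  -- the other inner contents.
  nth-injective : ∀ {ps i j} → Linked _>_ ps → All (0 <_) ps → i ≤ length ps → j ≤ length ps →
                  nth ps (suc i) ≡ nth ps (suc j) → i ≡ j
  nth-injective {i = i} {j} dec 0<ps i≤l j≤l eq with <-cmp i j
  ... | tri< i<j _ _ = contradiction (sym eq) (<⇒≢ (nth-strict dec 0<ps i<j j≤l))
  ... | tri≈ _ i≡j _ = i≡j
  ... | tri> _ _ j<i = contradiction eq (<⇒≢ (nth-strict dec 0<ps j<i i≤l))

  nth-extensional : ∀ {ps qs} → All (0 <_) ps → All (0 <_) qs → (∀ i → nth ps (suc i) ≡ nth qs (suc i)) → ps ≡ qs
  nth-extensional []          []          _ = refl
  nth-extensional []          (0<q ∷ _)   h = contradiction (h 0) (<⇒≢ 0<q)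
  nth-extensional (0<p ∷ _)   []          h = contradiction (sym (h 0)) (<⇒≢ 0<p)
  nth-extensional (_ ∷ 0<ps)  (_ ∷ 0<qs)  h = cong₂ _∷_ (h 0) (nth-extensional 0<ps 0<qs (h ∘ suc))

  -- Grow ps qs a: qs arises from ps by replacing the part a by suc a, where a = 0
  -- stands for appending a part 1.
  data Grow : List ℕ → List ℕ → ℕ → Set where
    append : Grow [] (1 ∷ []) 0
    here   : ∀ {a ps} → Grow (suc a ∷ ps) (suc (suc a) ∷ ps) (suc a)
    there  : ∀ {p ps qs a} → Grow ps qs a → Grow (p ∷ ps) (p ∷ qs) a

  -- Positivity rules out an empty row before row r of `qs`, so a row absent from `ps` can only be
  -- the one following its last.
  grow : ∀ {ps qs} r → All (0 <_) ps → All (0 <_) qs → nth qs (suc r) ≡ suc (nth ps (suc r)) →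
         (∀ i → i ≢ r → nth qs (suc i) ≡ nth ps (suc i)) → Grow ps qs (nth ps (suc r))
  grow r [] [] () _
  grow zero [] (_∷_ {xs = qs} 0<q 0<qs) refl other
    with refl ← nth-extensional 0<qs [] (λ i → other (suc i) λ ()) = append
  grow (suc r) [] (0<q ∷ _) _ other = contradiction (sym (other 0 λ ())) (<⇒≢ 0<q)
  grow zero (0<p ∷ 0<ps) [] () _
  grow (suc r) (0<p ∷ 0<ps) [] _ other = contradiction (other 0 λ ()) (<⇒≢ 0<p)
  grow zero (s≤s _ ∷ 0<ps) (_ ∷ 0<qs) refl other
    with refl ← nth-extensional 0<ps 0<qs (λ i → sym (other (suc i) λ ())) = here
  grow (suc r) (_ ∷ 0<ps) (_ ∷ 0<qs) eq other
    with refl ← other 0 (λ ()) = there (grow r 0<ps 0<qs eq (λ i i≢r → other (suc i) (i≢r ∘ suc-injective)))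

  sameRow : ∀ {ps qs i} → 0 < i → (∀ {j} → (i , j) ∈ diagram ps → (i , j) ∈ diagram qs) → nth ps i ≤ nth qs i
  sameRow {ps} {qs} {i} 0<i sub with nth ps i in eq
  ... | zero  = z≤n
  ... | suc p = +-cancelˡ-≤ i _ _ (proj₂ (proj₂ (∈-diagram⁻ qs (sub
    (∈-diagram⁺ ps 0<i (m<m+n i z<s) (+-monoʳ-≤ i (≤-reflexive (sym eq))))))))

  -- Rows are initial segments, so with □ the diagram of μ⁺ contains the first box missing from that
  -- row of μ; being new, this box is □. The last box of the same row of μ⁺ is old or equal to □, so
  -- the part grows by exactly one.
  addition⇒grow : ∀ {μ μ⁺ □} → IsAddition μ □ μ⁺ → ∃[ a ] (Grow (parts μ) (parts μ⁺) a × content □ ≡ suc a)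
  addition⇒grow {μ} {μ⁺} {zero  , c} (□∉μ , iff) =
    contradiction (proj₁ (∈-diagram⁻ (parts μ⁺) (Equivalence.from (iff _) (inj₂ refl)))) n≮0
  addition⇒grow {μ} {μ⁺} {suc r , c} (□∉μ , iff) =
    p , grow r (positive μ) (positive μ⁺) q≡ other ,
    trans (cong (_∸ R) c≡) (m+n∸m≡n R (suc p))
    where
    R = suc r
    ps = parts μ
    qs = parts μ⁺
    p = nth ps R
    q = nth qs R

    □∈μ⁺ : (R , c) ∈ diagram qs
    □∈μ⁺ = Equivalence.from (iff _) (inj₂ refl)

    r<c : R < c
    r<c = proj₁ (proj₂ (∈-diagram⁻ qs □∈μ⁺))

    beyond-p : R + p < c
    beyond-p = ≰⇒> λ c≤ → □∉μ (∈-diagram⁺ ps z<s r<c c≤)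

    c≡ : c ≡ R + suc p
    c≡ with Equivalence.to (iff (R , R + suc p)) (∈-diagram⁺ qs z<s (m<m+n R z<s)
              (≤-trans (≤-reflexive (+-suc R p)) (≤-trans beyond-p (proj₂ (proj₂ (∈-diagram⁻ qs □∈μ⁺))))))
    ... | inj₁ ∈μ = contradiction (+-cancelˡ-≤ R _ _ (proj₂ (proj₂ (∈-diagram⁻ ps ∈μ)))) (<⇒≱ ≤-refl)
    ... | inj₂ eq = sym (cong proj₂ eq)

    p<q : p < q
    p<q = +-cancelˡ-≤ R _ _ (subst (_≤ R + q) c≡ (proj₂ (proj₂ (∈-diagram⁻ qs □∈μ⁺))))

    q≤ : q ≤ suc p
    q≤ with Equivalence.to (iff (R , R + q)) (∈-diagram⁺ qs z<s (m<m+n R (≤-trans (s≤s z≤n) p<q)) ≤-refl)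
    ... | inj₁ ∈μ = contradiction (+-cancelˡ-≤ R _ _ (proj₂ (proj₂ (∈-diagram⁻ ps ∈μ)))) (<⇒≱ p<q)
    ... | inj₂ eq = ≤-reflexive (+-cancelˡ-≡ R _ _ (trans (cong proj₂ eq) c≡))

    q≡ : q ≡ suc p
    q≡ = ≤-antisym q≤ p<q

    other : ∀ i → i ≢ r → nth qs (suc i) ≡ nth ps (suc i)
    other i i≢r = ≤-antisym
      (sameRow {qs} {ps} z<s (λ ∈qs → case-⊎ (Equivalence.to (iff _) ∈qs)))
      (sameRow {ps} {qs} z<s (Equivalence.from (iff _) ∘ inj₁))
      where
      case-⊎ : ∀ {j} → (suc i , j) ∈ diagram ps ⊎ (suc i , j) ≡ (R , c) → (suc i , j) ∈ diagram ps
      case-⊎ (inj₁ ∈μ) = ∈μ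
      case-⊎ (inj₂ eq) = contradiction (suc-injective (cong proj₁ eq)) i≢r

  parts<head : ∀ {p ps} → Linked _>_ (p ∷ ps) → All (_< p) ps
  parts<head dec = AllPairs.head (Linked⇒AllPairs (λ x>y y>z → <-trans y>z x>y) dec)

  grow-∈ : ∀ {ps qs a} → Grow ps qs a → suc a ∈ qs
  grow-∈ append    = here refl
  grow-∈ here      = here refl
  grow-∈ (there g) = there (grow-∈ g)

  -- The strictly decreasing `qs` contains `suc a` only as its new part. Hence no outer content,
  -- being a part of the old partition, equals xᵢ.
  grow-≢ : ∀ {ps qs a} → Grow ps qs a → Linked _>_ qs → All (_≢ suc a) ps
  grow-≢ append    _   = []
  grow-≢ here      dec = <⇒≢ ≤-refl ∷ All.map <⇒≢ (parts<head dec)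
  grow-≢ (there g) dec = >⇒≢ (All.lookup (parts<head dec) (grow-∈ g)) ∷ grow-≢ g (Linked.tail dec)

  -- The effect of the growth on a row above it.

  module _ (p : ℕ) where

    differences sums : List ℕ → ℕ
    differences ps = product (map (p ∸_) ps)
    sums        ps = product (map (p +_) ps)

    differences≢0 : ∀ {ps} → All (_< p) ps → NonZero (differences ps)
    differences≢0 ps<p = product≢0 (All.map⁺ (All.map (λ lt → >-nonZero (m<n⇒0<n∸m lt)) ps<p))

    -- Only one entry changes. For `append` the absent part acts as a part 0, whose difference p - 0
    -- and sum p + 0 agree.
    grow-differences-sums : ∀ {ps qs a} → Grow ps qs a →
      sums ps * differences qs * ((p ∸ a) * (p + suc a)) ≡ sums qs * differences ps * ((p ∸ suc a) * (p + a))
    grow-differences-sums append = solve 2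
      (λ p r → con 1 :* (r :* con 1) :* (p :* (p :+ con 1))
            := (p :+ con 1) :* con 1 :* con 1 :* (r :* (p :+ con 0)))
      refl p (p ∸ 1)
      where open +-*-Solver
    grow-differences-sums (here {a} {ps}) = solve 6
        (λ s₀ s₁ d₀ d₁ S D → s₀ :* S :* (d₁ :* D) :* (d₀ :* s₁) := s₁ :* S :* (d₀ :* D) :* (d₁ :* s₀)) refl
        (p + suc a) (p + suc (suc a)) (p ∸ suc a) (p ∸ suc (suc a)) (sums ps) (differences ps)
      where open +-*-Solver
    grow-differences-sums (there {r} {ps} {qs} {a} g) = begin
      s * sums ps * (d * differences qs) * u    ≡⟨ regroup (sums ps) (differences qs) u ⟩
      s * d * (sums ps * differences qs * u)    ≡⟨ cong (s * d *_) (grow-differences-sums g) ⟩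
      s * d * (sums qs * differences ps * v)    ≡⟨ regroup (sums qs) (differences ps) v ⟨
      s * sums qs * (d * differences ps) * v    ∎
      where
      open +-*-Solver
      s = p + r
      d = p ∸ r
      u = (p ∸ a) * (p + suc a)
      v = (p ∸ suc a) * (p + a)
      regroup : ∀ S D u → s * S * (d * D) * u ≡ s * d * (S * D * u)
      regroup = solve 5 (λ s d S D u → s :* S :* (d :* D) :* u := s :* d :* (S :* D :* u)) refl s d

    -- The two row formulas share p!, so the quotient of the rows reduces to the changed entry.
    -- Cancellation is possible because all lower parts are smaller than p.
    grow-rowHooks : ∀ {ps qs a} → Grow ps qs a → Linked _>_ (p ∷ ps) → Linked _>_ (p ∷ qs) →
      rowHooks p ps * ((p ∸ a) * (p + suc a)) ≡ rowHooks p qs * ((p ∸ suc a) * (p + a))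
    grow-rowHooks {ps} {qs} {a} g dec dec⁺ =
      *-cancelʳ-≡ _ _ (differences ps * differences qs) (begin
        R * u * (D * D⁺)
          ≡⟨ solve 4 (λ r u d d⁺ → r :* u :* (d :* d⁺) := r :* d :* (d⁺ :* u)) refl R u D D⁺ ⟩
        R * D * (D⁺ * u)        ≡⟨ cong (_* (D⁺ * u)) (rowHooks-formula p ps dec) ⟩
        p ! * sums ps * (D⁺ * u)
          ≡⟨ solve 4 (λ f s d u → f :* s :* (d :* u) := f :* (s :* d :* u)) refl (p !) (sums ps) D⁺ u ⟩
        p ! * (sums ps * D⁺ * u) ≡⟨ cong (p ! *_) (grow-differences-sums g) ⟩
        p ! * (sums qs * D * v)
          ≡⟨ solve 4 (λ f s d u → f :* s :* (d :* u) := f :* (s :* d :* u)) refl (p !) (sums qs) D v ⟨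
        p ! * sums qs * (D * v)  ≡⟨ cong (_* (D * v)) (rowHooks-formula p qs dec⁺) ⟨
        R⁺ * D⁺ * (D * v)
          ≡⟨ solve 4 (λ r v d d⁺ → r :* d⁺ :* (d :* v) := r :* v :* (d :* d⁺)) refl R⁺ v D D⁺ ⟩
        R⁺ * v * (D * D⁺)       ∎)
      where
      open +-*-Solver
      R = rowHooks p ps
      R⁺ = rowHooks p qs
      D = differences ps
      D⁺ = differences qs
      u = (p ∸ a) * (p + suc a)
      v = (p ∸ suc a) * (p + a)
      instance
        _ = m*n≢0 D D⁺ {{differences≢0 (parts<head dec)}} {{differences≢0 (parts<head dec⁺)}}

  nC2-double : ∀ n → 2 * (n C 2) + n ≡ n * n
  nC2-double zero    = refl
  nC2-double (suc n) = begin
    2 * (suc n C 2) + suc n              ≡⟨ cong (λ c → 2 * c + suc n) (nCk+nC[k+1]≡[n+1]C[k+1] n 1) ⟨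
    2 * (n C 1 + n C 2) + suc n        ≡⟨ cong (λ c → 2 * (c + n C 2) + suc n) (nC1≡n n) ⟩
    2 * (n + n C 2) + suc n
      ≡⟨ solve 2 (λ n c → con 2 :* (n :+ c) :+ (con 1 :+ n) := con 2 :* c :+ n :+ (con 1 :+ con 2 :* n))
         refl n (n C 2) ⟩
    2 * (n C 2) + n + suc (2 * n)    ≡⟨ cong (_+ suc (2 * n)) (nC2-double n) ⟩
    n * n + suc (2 * n)
      ≡⟨ solve 1 (λ n → n :* n :+ (con 1 :+ con 2 :* n) := (con 1 :+ n) :* (con 1 :+ n)) refl n ⟩
    suc n * suc n                          ∎
    where open +-*-Solver

  open import Data.Fin.Base using (Fin; zero; suc)

  -- Outer corners, runs of consecutive parts and corner contents.

  nth-∈ : ∀ ps {i} → i < length ps → nth ps (suc i) ∈ ps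
  nth-∈ (p ∷ ps) {zero}  _         = here refl
  nth-∈ (p ∷ ps) {suc i} (s≤s i<l) = there (nth-∈ ps i<l)

  -- Position r is 0-indexed, so this concerns the row suc r; the last row needs no gap
  -- below it, since its part may drop to 0.
  Removable : List ℕ → ℕ → Set
  Removable ps r =
    0 < nth ps (suc r) × (0 < nth ps (suc (suc r)) → suc (suc (nth ps (suc (suc r)))) ≤ nth ps (suc r))

  removable? : ∀ ps r → Dec (Removable ps r)
  removable? ps r = (0 <? nth ps (suc r)) ×-dec ((0 <? nth ps (suc (suc r))) →-dec (_ ≤? _))

  linked-∷ : ∀ {p ps} → (0 < nth ps 1 → nth ps 1 < p) → All (0 <_) ps → Linked _>_ ps → Linked _>_ (p ∷ ps)
  linked-∷ h []        []  = [-]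
  linked-∷ h (0<q ∷ _) dec = h 0<q ∷ dec

  record Shrunk (ps : List ℕ) (r : ℕ) : Set where
    constructor shrunk
    field
      {rest}     : List ℕ
      rest-dec   : Linked _>_ rest
      rest-pos   : All (0 <_) rest
      nth-at     : suc (nth rest (suc r)) ≡ nth ps (suc r)
      nth-others : ∀ i → i ≢ r → nth rest (suc i) ≡ nth ps (suc i)

  -- A last part 1 is deleted, since a part 0 is not allowed; every other removable part is lowered
  -- by one.
  shrink : ∀ ps r → Linked _>_ ps → All (0 <_) ps → Removable ps r → Shrunk ps r
  shrink (suc zero ∷ []) zero _ _ _ = shrunk [] [] refl λ where
    zero    0≢0 → contradiction refl 0≢0
    (suc i) _   → refl
  shrink (suc (suc p) ∷ []) zero _ _ _ = shrunk [-] (z<s ∷ []) refl λ where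
    zero    0≢0 → contradiction refl 0≢0
    (suc i) _   → refl
  shrink (suc p ∷ q ∷ ps) zero (_ ∷ dec) (_ ∷ 0<q ∷ 0<ps) (_ , gap) =
    shrunk (≤-pred (gap 0<q) ∷ dec) (<-≤-trans z<s (≤-pred (gap 0<q)) ∷ 0<q ∷ 0<ps) refl λ where
      zero    0≢0 → contradiction refl 0≢0
      (suc i) _   → refl
  shrink (p ∷ ps) (suc r) dec (0<p ∷ 0<ps) rem with shrink ps r (Linked.tail dec) 0<ps rem
  ... | shrunk {qs} dec′ 0<qs at others =
    shrunk (linked-∷ (λ _ → ≤-<-trans head≤ head<) 0<qs dec′) (0<p ∷ 0<qs) at λ where
      zero    _   → refl
      (suc i) i≢r → others i (i≢r ∘ cong suc)
    where
    head≤ : nth qs 1 ≤ nth ps 1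
    head≤ with 0 ≟ r
    ... | yes refl = ≤-trans (n≤1+n _) (≤-reflexive at)
    ... | no 0≢r   = ≤-reflexive (others 0 0≢r)
    head< : nth ps 1 < p
    head< = nth-suc-< 0 dec 0<p

  removable⇒outerCorner : ∀ μ r → Removable (parts μ) r → IsOuterCorner μ (suc r , suc r + part μ (suc r))
  removable⇒outerCorner μ r rem with shrink (parts μ) r (decreasing μ) (positive μ) rem
  ... | shrunk {qs} dec 0<qs at others =
    ∈-diagram⁺ ps z<s (m<m+n R (proj₁ rem)) ≤-refl ,
    record { parts = qs ; decreasing = dec ; positive = 0<qs } ,
    λ c → mk⇔ (to c) (from c)
    where
    ps = parts μ
    R = suc r

    to : ∀ c → c ∈ diagram qs → c ∈ diagram ps × c ≢ (R , R + nth ps R)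
    to (i , j) c∈ with ∈-diagram⁻ qs c∈
    to (suc i , j) c∈ | _ , i<j , j≤ with i ≟ r
    ... | yes refl = ∈-diagram⁺ ps z<s i<j (<⇒≤ j<) , λ where refl → <-irrefl refl j<
      where
      j< : j < R + nth ps R
      j< = subst (λ z → j < R + z) at (subst (suc j ≤_) (sym (+-suc R _)) (s≤s j≤))
    ... | no i≢r = ∈-diagram⁺ ps z<s i<j (subst (λ z → j ≤ suc i + z) (others i i≢r) j≤) ,
                   λ where refl → i≢r refl

    from : ∀ c → c ∈ diagram ps × c ≢ (R , R + nth ps R) → c ∈ diagram qs
    from (i , j) (c∈ , c≢) with ∈-diagram⁻ ps c∈
    from (suc i , j) (c∈ , c≢) | _ , i<j , j≤ with i ≟ r
    ... | yes refl = ∈-diagram⁺ qs z<s i<j (≤-pred (subst (suc j ≤_) (+-suc R _)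
                       (subst (λ z → j < R + z) (sym at) (≤∧≢⇒< j≤ λ where refl → c≢ refl))))
    ... | no i≢r = ∈-diagram⁺ qs z<s i<j (subst (λ z → j ≤ suc i + z) (sym (others i i≢r)) j≤)

  -- If the row went on beyond b, its last box would survive in ν, and with it b, since the rows of
  -- ν have no holes.
  outerCorner-col : ∀ μ {b} → IsOuterCorner μ b → col b ≡ row b + part μ (row b)
  outerCorner-col μ {i , j} (b∈ , ν , iff) with ∈-diagram⁻ (parts μ) b∈ | j ≟ i + part μ i
  ... | _ | yes eq = eq
  ... | 0<i , i<j , j≤ | no j≢ = contradiction refl (proj₂ (Equivalence.to (iff (i , j)) b∈ν))
    where
    end∈ν : (i , i + part μ i) ∈ boxes ν
    end∈ν = Equivalence.from (iff _) (∈-diagram⁺ (parts μ) 0<i (<-≤-trans i<j j≤) ≤-refl , λ eq → j≢ (sym (cong proj₂ eq)))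
    b∈ν : (i , j) ∈ boxes ν
    b∈ν = ∈-diagram⁺ (parts ν) 0<i i<j (≤-trans j≤ (proj₂ (proj₂ (∈-diagram⁻ (parts ν) end∈ν))))

  -- The rows of a diagram read from row B up to row 1, with the outer corners
  -- met on the way.
  data Scan (ps : List ℕ) : ℕ → ∀ {m} → Vec Box m → Set where
    done      : Scan ps 0 []
    corner    : ∀ {B m} {v : Vec Box m} → 0 < nth ps (suc B) → Scan ps B v →
                Scan ps (suc B) ((suc B , suc B + nth ps (suc B)) ∷ v)
    noncorner : ∀ {B m} {v : Vec Box m} → 0 < nth ps (suc (suc B)) →
                nth ps (suc B) ≡ suc (nth ps (suc (suc B))) → Scan ps B v → Scan ps (suc B) v

  module _ (μ : StrictPartition) where
    private ps = parts μ

    -- Strict decrease gives a gap of at least one, and failure to be removable a gap of at most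
    -- one: such a row continues the run of the row below.
    notRemovable : ∀ {r} → r < ℓ μ → ¬ Removable ps r →
                   0 < nth ps (suc (suc r)) × nth ps (suc r) ≡ suc (nth ps (suc (suc r)))
    notRemovable {r} r<l ¬rem with 0 <? nth ps (suc (suc r))
    ... | no  ¬0<p = contradiction (nth-positive (positive μ) r<l , λ 0<p → contradiction 0<p ¬0<p) ¬rem
    ... | yes 0<p  = 0<p , ≤-antisym
      (≮⇒≥ λ lt → ¬rem (0<pᵣ , λ _ → lt))
      (nth-suc-< r (decreasing μ) 0<pᵣ)
      where 0<pᵣ = nth-positive (positive μ) r<l

    RowsDecreasing : ∀ {m} → Vec Box m → Set
    RowsDecreasing = VecLinked.Linked (λ b c → row b > row c)

    rows<head : ∀ {m c} {v : Vec Box m} → RowsDecreasing (c ∷ v) → VecAll.All (λ b → row b < row c) v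
    rows<head {v = []}    _                     = VecAll.[]
    rows<head {c = c} {v = _ ∷ _} (lt VecLinked.∷ lnk) =
      VecLinked.Linked⇒All {R = λ b c → row b > row c} (λ x>y y>z → <-trans y>z x>y) {v = c} lt lnk

    -- The rows in `v` decrease and are at most B, so only the head can lie in row B. If it does
    -- not, or if `v` is empty, completeness shows that row B is not removable.
    scan : ∀ B {m} (v : Vec Box m) → B ≤ ℓ μ → RowsDecreasing v →
           VecAll.All (IsOuterCorner μ) v → VecAll.All (λ b → row b ≤ B) v →
           (∀ r → r < B → Removable ps r → (suc r , suc r + nth ps (suc r)) VecM.∈ v) → Scan ps B v
    scan zero    []      _   _   _ _ _ = done
    scan zero    (c ∷ v) _   _   ((c∈ , _) VecAll.∷ _) (c≤0 VecAll.∷ _) _ =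
      contradiction (<-≤-trans (proj₁ (∈-diagram⁻ ps c∈)) c≤0) n≮0
    scan (suc B) []      B<l lnk ocs rows≤ complete =
      noncorner (proj₁ nr) (proj₂ nr) (scan B [] (<⇒≤ B<l) lnk ocs VecAll.[] (λ r r<B → complete r (m≤n⇒m≤1+n r<B)))
      where
      nr = notRemovable B<l λ rem → contradiction (complete B ≤-refl rem) λ ()
    scan (suc B) ((i , j) ∷ v) B<l lnk ocs (i≤ VecAll.∷ _) complete with i ≟ suc B
    scan (suc B) ((i , j) ∷ v) B<l lnk (oc VecAll.∷ ocs) (i≤ VecAll.∷ _) complete | yes refl rewrite outerCorner-col μ oc =
      corner (nth-positive (positive μ) B<l)
        (scan B v (<⇒≤ B<l) (VecLinked.tail lnk) ocs (VecAll.map ≤-pred (rows<head lnk))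
          λ r r<B rem → ∈-tail r<B (complete r (m≤n⇒m≤1+n r<B) rem))
      where
      ∈-tail : ∀ {r b c} → r < B → (suc r , b) VecM.∈ ((suc B , c) ∷ v) → (suc r , b) VecM.∈ v
      ∈-tail r<B (VecAny.here eq)  = contradiction (suc-injective (cong proj₁ eq)) (<⇒≢ r<B)
      ∈-tail r<B (VecAny.there ∈v) = ∈v
    scan (suc B) ((i , j) ∷ v) B<l lnk ocs (i≤ VecAll.∷ _) complete | no i≢ =
      noncorner (proj₁ nr) (proj₂ nr) (scan B _ (<⇒≤ B<l) lnk ocs rows≤B (λ r r<B → complete r (m≤n⇒m≤1+n r<B)))
      where
      i≤B = ≤-pred (≤∧≢⇒< i≤ i≢)
      rows≤B : VecAll.All (λ b → row b ≤ B) ((i , j) ∷ v)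
      rows≤B = i≤B VecAll.∷ VecAll.map (λ lt → ≤-trans (<⇒≤ lt) i≤B) (rows<head lnk)
      nr = notRemovable B<l λ rem → contradiction (VecAll.lookup rows≤B (complete B ≤-refl rem)) (<⇒≱ ≤-refl)

    outerCorners⇒scan : ∀ {m} {corners : Vec Box m} → IsOuterCorners μ corners → Scan ps (ℓ μ) corners
    outerCorners⇒scan {corners = corners} isC = scan (ℓ μ) corners ≤-refl rows-decreasing sound
      (VecAll.map row≤ℓ sound)
      (λ r _ rem → complete _ (removable⇒outerCorner μ r rem))
      where
      open IsOuterCorners isC
      row≤ℓ : ∀ {b} → IsOuterCorner μ b → row b ≤ ℓ μ
      row≤ℓ {i , j} (b∈ , _) with ∈-diagram⁻ ps b∈
      row≤ℓ {suc i , j} (b∈ , _) | _ , i<j , j≤ = nth>0⇒<length ps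
        (+-cancelˡ-< (suc i) _ _ (subst (_< suc i + nth ps (suc i)) (sym (+-identityʳ _)) (<-≤-trans i<j j≤)))

  -- The contents of the inner corners, with the column e in place of β₀; so
  -- x μ corners = xFrom (suc (ℓ μ)) corners.
  xFrom : ∀ {m} → ℕ → Vec Box m → Fin (suc m) → ℕ
  xFrom e v i = lookup (e ∷ Vec.map col v) i ∸ lookup (Vec.map row v ∷ʳ 0) i

  -- This is αᵢ₊₁; the inner corner i extends the row just below it.
  nextRow : ∀ {m} → Vec Box m → Fin (suc m) → ℕ
  nextRow v i = lookup (Vec.map row v ∷ʳ 0) i

  module _ {ps : List ℕ} where

    scan-endCol : ∀ {B} → nth ps (suc B) ≡ suc (nth ps (suc (suc B))) →
                  suc B + nth ps (suc B) ≡ suc (suc B) + nth ps (suc (suc B))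
    scan-endCol {B} eq = trans (cong (suc B +_) eq) (+-suc (suc B) _)

    -- The start column is the end of row B + 1. A noncorner row ends in the same column as the row
    -- below it, so the column carried along is still right when the next corner is met.
    xFrom≡part : ∀ {B m} {v : Vec Box m} → Scan ps B v → ∀ i →
                 xFrom (suc B + nth ps (suc B)) v i ≡ suc (nth ps (suc (nextRow v i)))
    xFrom≡part done zero = refl
    xFrom≡part (corner {B} _ s) zero    = trans (cong (_∸ suc B) (sym (+-suc (suc B) _))) (m+n∸m≡n (suc B) _)
    xFrom≡part (corner _ s)     (suc i) = xFrom≡part s i
    xFrom≡part (noncorner {v = v} _ eq s) i = trans (cong (λ e → xFrom e v i) (sym (scan-endCol eq))) (xFrom≡part s i)

    nextRow≤ : ∀ {B m} {v : Vec Box m} → Scan ps B v → ∀ i → nextRow v i ≤ B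
    nextRow≤ done zero = z≤n
    nextRow≤ (corner _ s) zero          = ≤-refl
    nextRow≤ (corner _ s) (suc i)       = m≤n⇒m≤1+n (nextRow≤ s i)
    nextRow≤ (noncorner _ _ s) i        = m≤n⇒m≤1+n (nextRow≤ s i)

    nextRow-injective : ∀ {B m} {v : Vec Box m} → Scan ps B v → ∀ i j → nextRow v i ≡ nextRow v j → i ≡ j
    nextRow-injective done zero zero _ = refl
    nextRow-injective (corner _ s) zero    zero    _  = refl
    nextRow-injective (corner _ s) zero    (suc j) eq = contradiction (subst (_≤ _) (sym eq) (nextRow≤ s j)) (<⇒≱ ≤-refl)
    nextRow-injective (corner _ s) (suc i) zero    eq = contradiction (subst (_≤ _) eq (nextRow≤ s i)) (<⇒≱ ≤-refl)
    nextRow-injective (corner _ s) (suc i) (suc j) eq = cong suc (nextRow-injective s i j eq)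
    nextRow-injective (noncorner _ _ s) i  j       eq = nextRow-injective s i j eq

    -- The last row is always a corner, since no positive part lies below it.
    nextRow-zero : ∀ {B m} {v : Vec Box m} → length ps ≤ B → Scan ps B v → nextRow v zero ≡ B
    nextRow-zero l≤B done              = refl
    nextRow-zero l≤B (corner _ _)      = refl
    nextRow-zero l≤B (noncorner 0<p _ _) = contradiction (subst (0 <_) (nth-beyond ps l≤B) 0<p) n≮0

    y≡part : ∀ {B m} {v : Vec Box m} → Scan ps B v → ∀ j → ∃[ r ] (r < B × y v j ≡ nth ps (suc r))
    y≡part (corner {B} _ s) zero    = B , ≤-refl , m+n∸m≡n (suc B) _
    y≡part (corner _ s) (suc j) = let r , r<B , eq = y≡part s j in r , m≤n⇒m≤1+n r<B , eq
    y≡part (noncorner _ _ s) j = let r , r<B , eq = y≡part s j in r , m≤n⇒m≤1+n r<B , eq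

  module _ (μ : StrictPartition) {m} {corners : Vec Box m} (s : Scan (parts μ) (ℓ μ) corners) where

    private
      -- β₀ is the end column of the empty row ℓ + 1.
      endCol : suc (ℓ μ) + nth (parts μ) (suc (ℓ μ)) ≡ suc (ℓ μ)
      endCol = trans (cong (suc (ℓ μ) +_) (nth-beyond (parts μ) ≤-refl)) (+-identityʳ _)

    x≡part : ∀ i → x μ corners i ≡ suc (part μ (suc (nextRow corners i)))
    x≡part i = trans (cong (λ e → xFrom e corners i) (sym endCol)) (xFrom≡part s i)

    x-zero : x μ corners zero ≡ 1
    x-zero = trans (x≡part zero)
      (cong suc (trans (cong (part μ ∘ suc) (nextRow-zero ≤-refl s)) (nth-beyond (parts μ) ≤-refl)))

    x-injective : ∀ {i j} → x μ corners i ≡ x μ corners j → i ≡ j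
    x-injective {i} {j} eq = nextRow-injective s i j (nth-injective (decreasing μ) (positive μ) (nextRow≤ s i) (nextRow≤ s j)
      (suc-injective (trans (sym (x≡part i)) (trans eq (x≡part j)))))

    y∈parts : ∀ j → y corners j ∈ parts μ
    y∈parts j = let r , r<l , eq = y≡part s j in subst (_∈ parts μ) (sym eq) (nth-∈ (parts μ) r<l)

open Diagrams
open import Data.Fin.Base using (Fin; zero; suc; toℕ; punchIn)
open import Data.Fin.Properties using (punchInᵢ≢i)
open import Data.Integer.Base as ℤ using (+_)
import Data.Integer.Properties as ℤ
open import Data.Rational.Base
  using (ℚ; 0ℚ; 1ℚ; ½; _+_; _*_; _-_; -_; _÷_; 1/_; _/_; NonZero; ≢-nonZero; fromℚᵘ)
open import Data.Rational.Properties
open import Data.Rational.Solver using (module +-*-Solver)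
open import Data.Rational.Unnormalised.Base as ℚᵘ using (mkℚᵘ; *≡*)
import Data.Rational.Unnormalised.Properties as ℚᵘ
open import Algebra.Properties.CommutativeMonoid.Sum *-1-commutativeMonoid
  using (sum-remove; sum-cong-≗)
open +-*-Solver

-- The embedding of ℕ in ℚ and products of rationals.

fromℚᵘ-homo-+ : ∀ p q → fromℚᵘ (p ℚᵘ.+ q) ≡ fromℚᵘ p + fromℚᵘ q
fromℚᵘ-homo-+ p q = toℚᵘ-injective (ℚᵘ.≃-trans (toℚᵘ-fromℚᵘ _) (ℚᵘ.≃-sym (ℚᵘ.≃-trans
  (toℚᵘ-homo-+ (fromℚᵘ p) (fromℚᵘ q))
  (ℚᵘ.+-cong (toℚᵘ-fromℚᵘ p) (toℚᵘ-fromℚᵘ q)))))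

fromℚᵘ-homo-* : ∀ p q → fromℚᵘ (p ℚᵘ.* q) ≡ fromℚᵘ p * fromℚᵘ q
fromℚᵘ-homo-* p q = toℚᵘ-injective (ℚᵘ.≃-trans (toℚᵘ-fromℚᵘ _) (ℚᵘ.≃-sym (ℚᵘ.≃-trans
  (toℚᵘ-homo-* (fromℚᵘ p) (fromℚᵘ q))
  (ℚᵘ.*-cong (toℚᵘ-fromℚᵘ p) (toℚᵘ-fromℚᵘ q)))))

opaque
  -- Being opaque, it enters later computations only through the laws proved for it, never through
  -- the normalisation of fractions.
  ι : ℕ → ℚ
  ι n = + n / 1

opaque
  unfolding ι

  ι-0 : ι 0 ≡ 0ℚ
  ι-0 = refl

  ι-1 : ι 1 ≡ 1ℚ
  ι-1 = refl

  binom₂≡ι : ∀ n → binom₂ n ≡ ι (n C 2)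
  binom₂≡ι n = refl

  ι-+ : ∀ m n → ι (m ℕ.+ n) ≡ ι m + ι n
  ι-+ m n = trans (cong (fromℚᵘ ∘ (λ i → mkℚᵘ i 0)) (sym (cong₂ ℤ._+_ (ℤ.*-identityʳ (+ m)) (ℤ.*-identityʳ (+ n)))))
                  (fromℚᵘ-homo-+ (mkℚᵘ (+ m) 0) (mkℚᵘ (+ n) 0))

  ι-* : ∀ m n → ι (m ℕ.* n) ≡ ι m * ι n
  ι-* m n = trans (cong (fromℚᵘ ∘ (λ i → mkℚᵘ i 0)) (ℤ.pos-* m n))
                  (fromℚᵘ-homo-* (mkℚᵘ (+ m) 0) (mkℚᵘ (+ n) 0))

  ι-injective : ∀ {m n} → ι m ≡ ι n → m ≡ n
  ι-injective {m} {n} eq with fromℚᵘ-injective {mkℚᵘ (+ m) 0} {mkℚᵘ (+ n) 0} eq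
  ... | *≡* h = ℤ.+-injective (ℤ.*-cancelʳ-≡ (+ m) (+ n) (+ 1) h)

  ι-fraction : ∀ m n .{{_ : ℕ.NonZero n}} → (+ m / n) * ι n ≡ ι m
  ι-fraction m (suc n) = trans (sym (fromℚᵘ-homo-* (mkℚᵘ (+ m) n) (mkℚᵘ (+ suc n) 0)))
    (fromℚᵘ-cong {mkℚᵘ (+ m) n ℚᵘ.* mkℚᵘ (+ suc n) 0} {mkℚᵘ (+ m) 0}
      (*≡* (trans (ℤ.*-identityʳ _) (cong (λ k → + m ℤ.* + suc k) (sym (ℕ.*-identityʳ n))))))

ι-∸ : ∀ {m n} → n ≤ m → ι (m ∸ n) ≡ ι m - ι n
ι-∸ {m} {n} n≤m = begin
  ι (m ∸ n)                 ≡⟨ solve 2 (λ d n → d := n :+ d :- n) refl (ι (m ∸ n)) (ι n) ⟩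
  ι n + ι (m ∸ n) - ι n     ≡⟨ cong (_- ι n) (ι-+ n (m ∸ n)) ⟨
  ι (n ℕ.+ (m ∸ n)) - ι n   ≡⟨ cong (λ z → ι z - ι n) (ℕ.m+[n∸m]≡n n≤m) ⟩
  ι m - ι n                 ∎

*-cancelˡ : ∀ {p q r} → p ≢ 0ℚ → p * q ≡ p * r → q ≡ r
*-cancelˡ {p} {q} {r} p≢0 eq = begin
  q               ≡⟨ undo q ⟨
  p⁻¹ * (p * q)   ≡⟨ cong (p⁻¹ *_) eq ⟩
  p⁻¹ * (p * r)   ≡⟨ undo r ⟩
  r               ∎
  where
  instance _ = ≢-nonZero p≢0
  p⁻¹ = 1/ p
  undo : ∀ s → p⁻¹ * (p * s) ≡ s
  undo s = trans (sym (*-assoc p⁻¹ p s)) (trans (cong (_* s) (*-inverseˡ p)) (*-identityˡ s))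

*-≢0 : ∀ {p q} → p ≢ 0ℚ → q ≢ 0ℚ → p * q ≢ 0ℚ
*-≢0 {p} p≢0 q≢0 eq = q≢0 (*-cancelˡ p≢0 (trans eq (sym (*-zeroʳ p))))

÷-unique : ∀ {p q r} .{{_ : NonZero q}} → r * q ≡ p → r ≡ p ÷ q
÷-unique {q = q} {r} refl = begin
  r               ≡⟨ *-identityʳ r ⟨
  r * 1ℚ          ≡⟨ cong (r *_) (*-inverseʳ q) ⟨
  r * (q * 1/ q)  ≡⟨ *-assoc r q (1/ q) ⟨
  r * q * 1/ q    ∎

Π : (ℕ → ℚ) → List ℕ → ℚ
Π g = foldr (λ p → g p *_) 1ℚ

Π-cong : ∀ {f g ps} → All (λ p → f p ≡ g p) ps → Π f ps ≡ Π g ps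
Π-cong []       = refl
Π-cong (e ∷ es) = cong₂ _*_ e (Π-cong es)

Π-* : ∀ f g ps → Π (λ p → f p * g p) ps ≡ Π f ps * Π g ps
Π-* f g []       = refl
Π-* f g (p ∷ ps) = trans (cong (f p * g p *_) (Π-* f g ps))
  (solve 4 (λ a b c d → a :* b :* (c :* d) := a :* c :* (b :* d)) refl (f p) (g p) (Π f ps) (Π g ps))

Π-≢0 : ∀ {g ps} → All (λ p → g p ≢ 0ℚ) ps → Π g ps ≢ 0ℚ
Π-≢0 []       = λ ()
Π-≢0 (h ∷ hs) = *-≢0 h (Π-≢0 hs)

ι-product : ∀ f ps → ι (product (map f ps)) ≡ Π (ι ∘ f) ps
ι-product f []       = ι-1
ι-product f (p ∷ ps) = trans (ι-* (f p) _) (cong (ι (f p) *_) (ι-product f ps))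

Π-applyUpTo-suc : ∀ g f n → Π g (applyUpTo f (suc n)) ≡ g (f n) * Π g (applyUpTo f n)
Π-applyUpTo-suc g f zero    = refl
Π-applyUpTo-suc g f (suc n) = trans (cong (g (f 0) *_) (Π-applyUpTo-suc g (f ∘ suc) n))
  (solve 3 (λ a b c → a :* (b :* c) := b :* (a :* c))
    refl (g (f 0)) (g (f (suc n))) (Π g (applyUpTo (f ∘ suc) n)))

applyUpTo-nth : ∀ ps → applyUpTo (nth ps ∘ suc) (length ps) ≡ ps
applyUpTo-nth []       = refl
applyUpTo-nth (p ∷ ps) = cong (p ∷_) (applyUpTo-nth ps)

∏-≢0 : ∀ {n} {f : Fin n → ℚ} → (∀ i → f i ≢ 0ℚ) → ∏ f ≢ 0ℚ
∏-≢0 {zero}  h = λ ()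
∏-≢0 {suc n} h = *-≢0 (h zero) (∏-≢0 (h ∘ suc))

-- Telescoping along the runs.

module Telescope (g : ℕ → ℚ) where

  -- The leading factor is pending from row B + 1. If row B continues the run, it equals `g` of the
  -- part of row B and joins the product on the right; if row B is a corner, it is the factor of an
  -- inner content, and the part of row B supplies that of an outer one.
  scan-telescopes : ∀ {ps B m} {v : Vec Box m} → Scan ps B v →
    g (suc (nth ps (suc B))) * Π (g ∘ suc) (applyUpTo (nth ps ∘ suc) B) * ∏ (g ∘ y v)
    ≡ ∏ (g ∘ xFrom (suc B ℕ.+ nth ps (suc B)) v) * Π g (applyUpTo (nth ps ∘ suc) B)
  scan-telescopes done = refl
  scan-telescopes {ps} (corner {B} {v = v} 0<p s) = begin
    a * Π (g ∘ suc) (rows (suc B)) * (g (y c∷v zero) * Y)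
      ≡⟨ cong₂ (λ s t → a * s * (t * Y)) (Π-applyUpTo-suc (g ∘ suc) _ B) (cong g (ℕ.m+n∸m≡n (suc B) _)) ⟩
    a * (b′ * T) * (b * Y)
      ≡⟨ solve 5 (λ a b′ t b y → a :* (b′ :* t) :* (b :* y) := a :* b :* (b′ :* t :* y)) refl a b′ T b Y ⟩
    a * b * (b′ * T * Y)
      ≡⟨ cong (a * b *_) (scan-telescopes s) ⟩
    a * b * (X * S)
      ≡⟨ solve 4 (λ a b x s → a :* b :* (x :* s) := a :* x :* (b :* s)) refl a b X S ⟩
    a * X * (b * S)
      ≡⟨ cong₂ (λ s t → g s * X * t) (sym (xFrom≡part (corner 0<p s) zero)) (sym (Π-applyUpTo-suc g _ B)) ⟩
    ∏ (g ∘ xFrom (suc (suc B) ℕ.+ nth ps (suc (suc B))) c∷v) * Π g (rows (suc B)) ∎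
    where
    rows = applyUpTo (nth ps ∘ suc)
    c∷v = (suc B , suc B ℕ.+ nth ps (suc B)) ∷ v
    a = g (suc (nth ps (suc (suc B))))
    b = g (nth ps (suc B))
    b′ = g (suc (nth ps (suc B)))
    T = Π (g ∘ suc) (rows B)
    S = Π g (rows B)
    Y = ∏ (g ∘ y v)
    X = ∏ (g ∘ xFrom (suc B ℕ.+ nth ps (suc B)) v)
  scan-telescopes {ps} (noncorner {B} {v = v} _ eq s) = begin
    g (suc (nth ps (suc (suc B)))) * Π (g ∘ suc) (rows (suc B)) * Y
      ≡⟨ cong₂ (λ s t → g s * t * Y) (sym eq) (Π-applyUpTo-suc (g ∘ suc) _ B) ⟩
    b * (b′ * T) * Y
      ≡⟨ solve 4 (λ b b′ t y → b :* (b′ :* t) :* y := b :* (b′ :* t :* y)) refl b b′ T Y ⟩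
    b * (b′ * T * Y)
      ≡⟨ cong (b *_) (scan-telescopes s) ⟩
    b * (∏ (g ∘ xFrom e v) * S)
      ≡⟨ solve 3 (λ b x s → b :* (x :* s) := x :* (b :* s)) refl b (∏ (g ∘ xFrom e v)) S ⟩
    ∏ (g ∘ xFrom e v) * (b * S)
      ≡⟨ cong₂ (λ e s → ∏ (g ∘ xFrom e v) * s) (scan-endCol {ps} eq) (sym (Π-applyUpTo-suc g _ B)) ⟩
    ∏ (g ∘ xFrom (suc (suc B) ℕ.+ nth ps (suc (suc B))) v) * Π g (rows (suc B)) ∎
    where
    rows = applyUpTo (nth ps ∘ suc)
    e = suc B ℕ.+ nth ps (suc B)
    b = g (nth ps (suc B))
    b′ = g (suc (nth ps (suc B)))
    T = Π (g ∘ suc) (rows B)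
    S = Π g (rows B)
    Y = ∏ (g ∘ y v)

  -- Reading starts below the last row, where the part is 0; hence the pending factor `g 1`.
  corners-telescope : ∀ μ {m} {corners : Vec Box m} → Scan (parts μ) (ℓ μ) corners →
    g 1 * Π (g ∘ suc) (parts μ) * ∏ (g ∘ y corners) ≡ ∏ (g ∘ x μ corners) * Π g (parts μ)
  corners-telescope μ {corners = corners} s =
    subst (λ e → g 1 * Π (g ∘ suc) (parts μ) * ∏ (g ∘ y corners) ≡ ∏ (g ∘ xFrom e corners) * Π g (parts μ))
      (ℕ.+-identityʳ (suc (ℓ μ)))
      (subst₂ (λ ps n → g (suc n) * Π (g ∘ suc) ps * ∏ (g ∘ y corners)
                       ≡ ∏ (g ∘ xFrom (suc (ℓ μ) ℕ.+ n) corners) * Π g ps)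
        (applyUpTo-nth (parts μ)) (nth-beyond (parts μ) ℕ.≤-refl) (scan-telescopes s))

-- The weight f and the comparison of hook products.

2ℚ : ℚ
2ℚ = 1ℚ + 1ℚ

ι-2 : ι 2 ≡ 2ℚ
ι-2 = trans (ι-+ 1 1) (cong₂ _+_ ι-1 ι-1)

binom₂-formula : ∀ n → binom₂ n ≡ ½ * (ι n * ι n - ι n)
binom₂-formula n = begin
  binom₂ n                            ≡⟨ binom₂≡ι n ⟩
  b
    ≡⟨ solve 2 (λ b n → b := con ½ :* (con 2ℚ :* b :+ n :- n)) refl b (ι n) ⟩
  ½ * (2ℚ * b + ι n - ι n)           ≡⟨ cong (λ z → ½ * (z * b + ι n - ι n)) ι-2 ⟨
  ½ * (ι 2 * b + ι n - ι n)           ≡⟨ cong (λ z → ½ * (z + ι n - ι n)) (ι-* 2 (n C 2)) ⟨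
  ½ * (ι (2 ℕ.* (n C 2)) + ι n - ι n) ≡⟨ cong (λ z → ½ * (z - ι n)) (ι-+ (2 ℕ.* (n C 2)) n) ⟨
  ½ * (ι (2 ℕ.* (n C 2) ℕ.+ n) - ι n) ≡⟨ cong (λ z → ½ * (ι z - ι n)) (nC2-double n) ⟩
  ½ * (ι (n ℕ.* n) - ι n)             ≡⟨ cong (λ z → ½ * (z - ι n)) (ι-* n n) ⟩
  ½ * (ι n * ι n - ι n)               ∎
  where b = ι (n C 2)

ι-suc : ∀ n → ι (suc n) ≡ 1ℚ + ι n
ι-suc n = trans (ι-+ 1 n) (cong (_+ ι n) ι-1)

module Weight (a : ℕ) where

  f : ℕ → ℚ
  f n = binom₂ (suc a) - binom₂ n

  f-factor : ∀ n → f n ≡ ½ * (ι (a ℕ.+ n) * (ι (suc a) - ι n))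
  f-factor n = begin
    binom₂ (suc a) - binom₂ n ≡⟨ cong₂ _-_ (binom₂-formula (suc a)) (binom₂-formula n) ⟩
    ½ * (ι (suc a) * ι (suc a) - ι (suc a)) - ½ * (ι n * ι n - ι n)
      ≡⟨ cong (λ z → ½ * (z * z - z) - ½ * (ι n * ι n - ι n)) (ι-suc a) ⟩
    ½ * ((1ℚ + ι a) * (1ℚ + ι a) - (1ℚ + ι a)) - ½ * (ι n * ι n - ι n)
      ≡⟨ solve 2 (λ a n → con ½ :* ((con 1ℚ :+ a) :* (con 1ℚ :+ a) :- (con 1ℚ :+ a)) :- con ½ :* (n :* n :- n)
                       := con ½ :* ((a :+ n) :* (con 1ℚ :+ a :- n))) refl (ι a) (ι n) ⟩
    ½ * ((ι a + ι n) * (1ℚ + ι a - ι n)) ≡⟨ cong₂ (λ s t → ½ * (s * (t - ι n))) (ι-+ a n) (ι-suc a) ⟨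
    ½ * (ι (a ℕ.+ n) * (ι (suc a) - ι n)) ∎

  f-≤ : ∀ {n} → n ≤ suc a → f n ≡ ½ * (ι (a ℕ.+ n) * ι (suc a ∸ n))
  f-≤ {n} n≤ = trans (f-factor n) (cong (λ z → ½ * (ι (a ℕ.+ n) * z)) (sym (ι-∸ n≤)))

  -- Here f is nonpositive. The reversed difference makes the truncated subtraction exact, and the
  -- factor -½ is shared by f(b) and f(b + 1) for parts b above the grown one.
  f-≥ : ∀ {n} → suc a ≤ n → f n ≡ - ½ * ι ((n ∸ suc a) ℕ.* (n ℕ.+ a))
  f-≥ {n} ≤n = begin
    f n                                         ≡⟨ f-factor n ⟩
    ½ * (ι (a ℕ.+ n) * (ι (suc a) - ι n))
      ≡⟨ solve 3 (λ s a n → con ½ :* (s :* (a :- n)) := con (- ½) :* ((n :- a) :* s))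
         refl (ι (a ℕ.+ n)) (ι (suc a)) (ι n) ⟩
    - ½ * ((ι n - ι (suc a)) * ι (a ℕ.+ n))
      ≡⟨ cong₂ (λ d s → - ½ * (d * ι s)) (sym (ι-∸ ≤n)) (ℕ.+-comm a n) ⟩
    - ½ * (ι (n ∸ suc a) * ι (n ℕ.+ a))         ≡⟨ cong (- ½ *_) (ι-* (n ∸ suc a) (n ℕ.+ a)) ⟨
    - ½ * ι ((n ∸ suc a) ℕ.* (n ℕ.+ a))         ∎

  ι-pos : ∀ {n} → 0 < n → ι n ≢ 0ℚ
  ι-pos 0<n eq = ℕ.<⇒≢ 0<n (sym (ι-injective (trans eq (sym ι-0))))

  f≢0 : ∀ {n} → 0 < n → n ≢ suc a → f n ≢ 0ℚ
  f≢0 {n} 0<n n≢ eq =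
    *-≢0 {½} (λ ()) (*-≢0 (ι-pos (ℕ.<-≤-trans 0<n (ℕ.m≤n+m n a))) diff≢0) (trans (sym (f-factor n)) eq)
    where
    diff≢0 : ι (suc a) - ι n ≢ 0ℚ
    diff≢0 eq = n≢ (ι-injective (begin
      ι n                         ≡⟨ solve 2 (λ a n → n := a :- (a :- n)) refl (ι (suc a)) (ι n) ⟩
      ι (suc a) - (ι (suc a) - ι n) ≡⟨ cong (λ z → ι (suc a) - z) eq ⟩
      ι (suc a) - 0ℚ              ≡⟨ solve 1 (λ a → a :- con 0ℚ := a) refl (ι (suc a)) ⟩
      ι (suc a)                   ∎))

  -- f with its zero at suc a removed, so that products of values of g can be cancelled.
  g : ℕ → ℚ
  g n with n ℕ.≟ suc a
  ... | yes _ = 1ℚ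
  ... | no  _ = f n

  g-pole : g (suc a) ≡ 1ℚ
  g-pole with suc a ℕ.≟ suc a
  ... | yes _ = refl
  ... | no ≢  = contradiction refl ≢

  g≡f : ∀ {n} → n ≢ suc a → g n ≡ f n
  g≡f {n} n≢ with n ℕ.≟ suc a
  ... | yes eq = contradiction eq n≢
  ... | no _   = refl

  g≢0 : ∀ {n} → 0 < n → g n ≢ 0ℚ
  g≢0 {n} 0<n with n ℕ.≟ suc a
  ... | yes _ = λ ()
  ... | no n≢ = f≢0 0<n n≢

-- 2 binom₂ (suc a) for a > 0; the value at 0 accounts for the appended part 1.
scale : ℕ → ℚ
scale zero    = 1ℚ
scale (suc a) = ι (suc a) * ι (suc (suc a))

module _ where
  open Weight

  -- As f(b) = ½ (a + b)(a + 1 - b) and f(b + 1) = ½ (a + 1 + b)(a - b), each product of weights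
  -- pairs the sums of one row with the differences of the other. The factor a + 1 comes from (a +
  -- 1)! / a!.
  replace-row : ∀ a ps → Linked _>_ (a ∷ ps) →
    ι (rowHooks a ps) * ι (suc a) * Π (f a ∘ suc) ps ≡ ι (rowHooks (suc a) ps) * Π (f a) ps
  replace-row a ps dec = begin
    R * ι (suc a) * Π (f a ∘ suc) ps   ≡⟨ cong (R * ι (suc a) *_) Πf∘suc ⟩
    R * ι (suc a) * (h * (S⁺ * D))
      ≡⟨ solve 5 (λ r a h s d → r :* a :* (h :* (s :* d)) := a :* h :* s :* (r :* d))
         refl R (ι (suc a)) h S⁺ D ⟩
    ι (suc a) * h * S⁺ * (R * D)       ≡⟨ cong (ι (suc a) * h * S⁺ *_) (rowFormula a dec) ⟩
    ι (suc a) * h * S⁺ * (ι (a !) * S)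
      ≡⟨ solve 5 (λ a h s⁺ f s → a :* h :* s⁺ :* (f :* s) := a :* f :* s⁺ :* (h :* s))
         refl (ι (suc a)) h S⁺ (ι (a !)) S ⟩
    ι (suc a) * ι (a !) * S⁺ * (h * S) ≡⟨ cong (λ z → z * S⁺ * (h * S)) (ι-* (suc a) (a !)) ⟨
    ι (suc a !) * S⁺ * (h * S)         ≡⟨ cong (_* (h * S)) (rowFormula (suc a) dec⁺) ⟨
    R⁺ * D⁺ * (h * S)
      ≡⟨ solve 4 (λ r d h s → r :* d :* (h :* s) := r :* (h :* (s :* d))) refl R⁺ D⁺ h S ⟩
    R⁺ * (h * (S * D⁺))                ≡⟨ cong (R⁺ *_) Πf ⟨
    R⁺ * Π (f a) ps                    ∎
    where
    R = ι (rowHooks a ps)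
    R⁺ = ι (rowHooks (suc a) ps)
    h = Π (λ _ → ½) ps
    S = Π (ι ∘ (a ℕ.+_)) ps
    S⁺ = Π (ι ∘ (suc a ℕ.+_)) ps
    D = Π (ι ∘ (a ∸_)) ps
    D⁺ = Π (ι ∘ (suc a ∸_)) ps

    dec⁺ : Linked _>_ (suc a ∷ ps)
    dec⁺ = raise dec
      where
      raise : ∀ {a ps} → Linked _>_ (a ∷ ps) → Linked _>_ (suc a ∷ ps)
      raise [-]         = [-]
      raise (a>p ∷ dec) = ℕ.m<n⇒m<1+n a>p ∷ dec

    rowFormula : ∀ p → Linked _>_ (p ∷ ps) → ι (rowHooks p ps) * Π (ι ∘ (p ∸_)) ps ≡ ι (p !) * Π (ι ∘ (p ℕ.+_)) ps
    rowFormula p dec = begin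
      ι (rowHooks p ps) * Π (ι ∘ (p ∸_)) ps      ≡⟨ cong (ι (rowHooks p ps) *_) (ι-product (p ∸_) ps) ⟨
      ι (rowHooks p ps) * ι (differences p ps)   ≡⟨ ι-* (rowHooks p ps) (differences p ps) ⟨
      ι (rowHooks p ps ℕ.* differences p ps)     ≡⟨ cong ι (rowHooks-formula p ps dec) ⟩
      ι (p ! ℕ.* sums p ps)                      ≡⟨ ι-* (p !) (sums p ps) ⟩
      ι (p !) * ι (sums p ps)                    ≡⟨ cong (ι (p !) *_) (ι-product (p ℕ.+_) ps) ⟩
      ι (p !) * Π (ι ∘ (p ℕ.+_)) ps              ∎

    split : ∀ s d → Π (λ b → ½ * (s b * d b)) ps ≡ h * (Π s ps * Π d ps)
    split s d = trans (Π-* (λ _ → ½) (λ b → s b * d b) ps) (cong (h *_) (Π-* s d ps))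

    Πf∘suc : Π (f a ∘ suc) ps ≡ h * (S⁺ * D)
    Πf∘suc = trans (Π-cong (All.map
        (λ {b} b<a → trans (f-≤ a (s≤s (ℕ.<⇒≤ b<a))) (cong (λ z → ½ * (ι z * ι (a ∸ b))) (ℕ.+-suc a b)))
        (parts<head dec)))
                   (split (ι ∘ (suc a ℕ.+_)) (ι ∘ (a ∸_)))

    Πf : Π (f a) ps ≡ h * (S * D⁺)
    Πf = trans (Π-cong (All.map (λ b<a → f-≤ a (ℕ.m≤n⇒m≤1+n (ℕ.<⇒≤ b<a))) (parts<head dec)))
               (split (ι ∘ (a ℕ.+_)) (ι ∘ (suc a ∸_)))

  -- A row above the grown one contributes by `grow-rowHooks`, and rows below it are unchanged. At
  -- the grown part, `g (suc a)` is 1 and `g a` is a, so `scale a` must supply a as well as the a +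
  -- 1 of `replace-row`.
  grow-H : ∀ {ps qs a} → Grow ps qs a → Linked _>_ ps → Linked _>_ qs →
    ι (Hᴸ ps) * scale a * Π (g a ∘ suc) ps ≡ ι (Hᴸ qs) * Π (g a) ps
  -- Both hook products compute to 1: a diagram of one box has hook 1.
  grow-H append _ _ = *-identityʳ (ι 1 * 1ℚ)
  grow-H (here {a′} {ps}) dec dec⁺ = begin
    ι (Hᴸ (a ∷ ps)) * (ι a * ι (suc a)) * (g a (suc a) * Π (g a ∘ suc) ps)
      ≡⟨ cong₂ (λ s t → s * (ι a * ι (suc a)) * t) (ιH a)
           (cong₂ _*_ (g-pole a) (Π-cong (All.map (λ b<a → g≡f a (ℕ.<⇒≢ (s≤s b<a))) ps<a))) ⟩
    ι (rowHooks a ps) * ι (Hᴸ ps) * (ι a * ι (suc a)) * (1ℚ * Π (f a ∘ suc) ps)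
      ≡⟨ solve 5 (λ r h a a⁺ p → r :* h :* (a :* a⁺) :* (con 1ℚ :* p) := h :* a :* (r :* a⁺ :* p))
         refl (ι (rowHooks a ps)) (ι (Hᴸ ps)) (ι a) (ι (suc a)) (Π (f a ∘ suc) ps) ⟩
    ι (Hᴸ ps) * ι a * (ι (rowHooks a ps) * ι (suc a) * Π (f a ∘ suc) ps)
      ≡⟨ cong (ι (Hᴸ ps) * ι a *_) (replace-row a ps dec) ⟩
    ι (Hᴸ ps) * ι a * (ι (rowHooks (suc a) ps) * Π (f a) ps)
      ≡⟨ solve 4 (λ h a r p → h :* a :* (r :* p) := r :* h :* (a :* p))
         refl (ι (Hᴸ ps)) (ι a) (ι (rowHooks (suc a) ps)) (Π (f a) ps) ⟩
    ι (rowHooks (suc a) ps) * ι (Hᴸ ps) * (ι a * Π (f a) ps)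
      ≡⟨ cong₂ _*_ (ιH (suc a))
           (cong₂ _*_ ga (Π-cong (All.map (λ b<a → g≡f a (ℕ.<⇒≢ (ℕ.m<n⇒m<1+n b<a))) ps<a))) ⟨
    ι (Hᴸ (suc a ∷ ps)) * (g a a * Π (g a) ps) ∎
    where
    a = suc a′
    ps<a = parts<head dec
    ιH : ∀ p → ι (Hᴸ (p ∷ ps)) ≡ ι (rowHooks p ps) * ι (Hᴸ ps)
    ιH p = trans (cong ι (Hᴸ-∷ p ps)) (ι-* (rowHooks p ps) (Hᴸ ps))
    ga : g a a ≡ ι a
    ga = begin
      g a a                                ≡⟨ g≡f a (ℕ.<⇒≢ ℕ.≤-refl) ⟩
      f a a                                ≡⟨ f-factor a a ⟩
      ½ * (ι (a ℕ.+ a) * (ι (suc a) - ι a)) ≡⟨ cong₂ (λ s t → ½ * (s * (t - ι a))) (ι-+ a a) (ι-suc a) ⟩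
      ½ * ((ι a + ι a) * (1ℚ + ι a - ι a))
        ≡⟨ solve 1 (λ a → con ½ :* ((a :+ a) :* (con 1ℚ :+ a :- a)) := a) refl (ι a) ⟩
      ι a                                  ∎
  grow-H (there {p} {ps} {qs} {a} gr) dec dec⁺ = begin
    ι (Hᴸ (p ∷ ps)) * scale a * (g a (suc p) * P⁺)
      ≡⟨ cong₂ (λ s t → s * scale a * (t * P⁺)) (ιH ps)
           (trans (g≡f a (ℕ.>⇒≢ (s≤s a<p))) (f-≥ a (s≤s (ℕ.<⇒≤ a<p)))) ⟩
    R * ι (Hᴸ ps) * scale a * (- ½ * ι u * P⁺)
      ≡⟨ solve 6 (λ r h c k u p → r :* h :* c :* (k :* u :* p) := k :* (r :* u) :* (h :* c :* p))
         refl R (ι (Hᴸ ps)) (scale a) (- ½) (ι u) P⁺ ⟩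
    - ½ * (R * ι u) * (ι (Hᴸ ps) * scale a * P⁺)
      ≡⟨ cong₂ (λ s t → - ½ * s * t) rows (grow-H gr (Linked.tail dec) (Linked.tail dec⁺)) ⟩
    - ½ * (R⁺ * ι v) * (ι (Hᴸ qs) * P)
      ≡⟨ solve 5 (λ r h k v p → k :* (r :* v) :* (h :* p) := r :* h :* (k :* v :* p))
         refl R⁺ (ι (Hᴸ qs)) (- ½) (ι v) P ⟩
    R⁺ * ι (Hᴸ qs) * (- ½ * ι v * P)
      ≡⟨ cong₂ (λ s t → s * (t * P)) (ιH qs) (trans (g≡f a (ℕ.>⇒≢ suca<p)) (f-≥ a a<p)) ⟨
    ι (Hᴸ (p ∷ qs)) * (g a p * P) ∎
    where
    suca<p : suc a < p
    suca<p = All.lookup (parts<head dec⁺) (grow-∈ gr)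
    a<p : a < p
    a<p = ℕ.<⇒≤ suca<p
    P = Π (g a) ps
    P⁺ = Π (g a ∘ suc) ps
    R = ι (rowHooks p ps)
    R⁺ = ι (rowHooks p qs)
    u = (p ∸ a) ℕ.* (suc p ℕ.+ a)
    v = (p ∸ suc a) ℕ.* (p ℕ.+ a)
    ιH : ∀ qs → ι (Hᴸ (p ∷ qs)) ≡ ι (rowHooks p qs) * ι (Hᴸ qs)
    ιH qs = trans (cong ι (Hᴸ-∷ p qs)) (ι-* (rowHooks p qs) (Hᴸ qs))
    rows : R * ι u ≡ R⁺ * ι v
    rows = begin
      R * ι u                                                   ≡⟨ ι-* (rowHooks p ps) u ⟨
      ι (rowHooks p ps ℕ.* u)
        ≡⟨ cong (λ s → ι (rowHooks p ps ℕ.* ((p ∸ a) ℕ.* s))) (ℕ.+-suc p a) ⟨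
      ι (rowHooks p ps ℕ.* ((p ∸ a) ℕ.* (p ℕ.+ suc a)))         ≡⟨ cong ι (grow-rowHooks p gr dec dec⁺) ⟩
      ι (rowHooks p qs ℕ.* v)                                   ≡⟨ ι-* (rowHooks p qs) v ⟩
      R⁺ * ι v                                                  ∎

-- For a > 0, `g 1` is C(a + 1, 2), half of a (a + 1): this is the origin of the ½ in the theorem.
-- For a = 0 the point 1 is the removed zero, where `g` and `scale` are both 1.
scale-suc : ∀ {a} → a ≢ 0 → scale a ≡ 2ℚ * Weight.g a 1
scale-suc {zero} a≢0 = contradiction refl a≢0
scale-suc {suc a} _ = sym (begin
  2ℚ * g 1
    ≡⟨ cong (2ℚ *_) (trans (g≡f {1} (λ ())) (f-≤ {1} (s≤s z≤n))) ⟩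
  2ℚ * (½ * (ι (suc a ℕ.+ 1) * ι (suc a)))
    ≡⟨ cong (λ n → 2ℚ * (½ * (ι n * ι (suc a)))) (ℕ.+-comm (suc a) 1) ⟩
  2ℚ * (½ * (ι (suc (suc a)) * ι (suc a)))
    ≡⟨ solve 2 (λ a b → con 2ℚ :* (con ½ :* (b :* a)) := a :* b) refl (ι (suc a)) (ι (suc (suc a))) ⟩
  ι (suc a) * ι (suc (suc a))                               ∎)
  where open Weight (suc a)

-- Assembly of the quotient.

module HookRatio (μ : StrictPartition) {m : ℕ} (corners : Vec Box m) (isC : IsOuterCorners μ corners)
         (i : Fin (suc m)) (μ⁺ : StrictPartition) {a : ℕ} (gr : Grow (parts μ) (parts μ⁺) a)
         (xᵢ≡ : x μ corners i ≡ suc a) where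

  private
    open Weight a
    s = outerCorners⇒scan μ isC
    h h⁺ Πg : ℚ
    h = ι (H μ)
    h⁺ = ι (H μ⁺)
    Πg = Π g (parts μ)
    Πg⁺ = Π (g ∘ suc) (parts μ)
    Y = ∏ (g ∘ y corners)
    Xs = ∏ (g ∘ x μ corners)

    X≡ : binom₂ (x μ corners i) ≡ binom₂ (suc a)
    X≡ = cong binom₂ xᵢ≡

    part≢ : All (_≢ suc a) (parts μ)
    part≢ = grow-≢ gr (decreasing μ⁺)

  num den : ℚ
  num = ∏ (λ j → binom₂ (x μ corners i) - binom₂ (y corners j))
  den = ∏ (removeAt (λ j → binom₂ (x μ corners i) - binom₂ (x μ corners j)) i)

  Y≡num : Y ≡ num
  Y≡num = sum-cong-≗ (λ j → trans (g≡f (All.lookup part≢ (y∈parts μ s j))) (cong (_- binom₂ (y corners j)) (sym X≡)))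

  removed : ∀ j → x μ corners (punchIn i j) ≢ suc a
  removed j eq = punchInᵢ≢i i j (x-injective μ s (trans eq (sym xᵢ≡)))

  den-factor : ∀ j → g (x μ corners (punchIn i j)) ≡ binom₂ (x μ corners i) - binom₂ (x μ corners (punchIn i j))
  den-factor j = trans (g≡f (removed j)) (cong (_- binom₂ (x μ corners (punchIn i j))) (sym X≡))

  -- The factor at xᵢ = a + 1 is the removed zero, hence 1; by distinctness no other inner content
  -- meets it.
  Xs≡den : Xs ≡ den
  Xs≡den = begin
    Xs                                                        ≡⟨ sum-remove {i = i} (g ∘ x μ corners) ⟩
    g (x μ corners i) * ∏ (removeAt (g ∘ x μ corners) i)
      ≡⟨ cong₂ _*_ (trans (cong g xᵢ≡) g-pole) (sum-cong-≗ den-factor) ⟩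
    1ℚ * den                                                  ≡⟨ *-identityˡ den ⟩
    den                                                       ∎

  den≢0 : den ≢ 0ℚ
  den≢0 = ∏-≢0 (λ j eq → g≢0 (subst (0 <_) (sym (x≡part μ s (punchIn i j))) z<s) (trans (den-factor j) eq))

  -- Telescoping trades `Xs * Πg` for `g 1 * Πg⁺ * Y`, and `grow-H` trades `h * scale a * Πg⁺` for
  -- `h⁺ * Πg`. The common `Πg` is nonzero because the parts are positive.
  cross-multiplied : h * scale a * den ≡ g 1 * (h⁺ * num)
  cross-multiplied = subst₂ (λ X Y → h * scale a * X ≡ g 1 * (h⁺ * Y)) Xs≡den Y≡num
    (*-cancelˡ (Π-≢0 {ps = parts μ} (All.map g≢0 (positive μ))) (begin
    Πg * (h * scale a * Xs)
      ≡⟨ solve 4 (λ p h c x → p :* (h :* c :* x) := h :* c :* (x :* p)) refl Πg h (scale a) Xs ⟩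
    h * scale a * (Xs * Πg)       ≡⟨ cong (h * scale a *_) (Telescope.corners-telescope g μ s) ⟨
    h * scale a * (g 1 * Πg⁺ * Y)
      ≡⟨ solve 5 (λ h c g p y → h :* c :* (g :* p :* y) := g :* (h :* c :* p) :* y)
         refl h (scale a) (g 1) Πg⁺ Y ⟩
    g 1 * (h * scale a * Πg⁺) * Y ≡⟨ cong (λ z → g 1 * z * Y) (grow-H gr (decreasing μ) (decreasing μ⁺)) ⟩
    g 1 * (h⁺ * Πg) * Y
      ≡⟨ solve 4 (λ g h p y → g :* (h :* p) :* y := p :* (g :* (h :* y))) refl (g 1) h⁺ Πg Y ⟩
    Πg * (g 1 * (h⁺ * Y))         ∎))

  -- κ is 1 when a part 1 is appended and 2 when a part grows; `g 1` then cancels in both cases.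
  ratio : ∀ {κ} → scale a ≡ κ * g 1 → κ * H-ratio μ μ⁺ * den ≡ num
  ratio {κ} scale≡ = *-cancelˡ (*-≢0 (g≢0 {1} z<s) h⁺≢0) (begin
    g 1 * h⁺ * (κ * r * den)
      ≡⟨ solve 5 (λ g h k r d → g :* h :* (k :* r :* d) := r :* h :* (k :* g) :* d) refl (g 1) h⁺ κ r den ⟩
    r * h⁺ * (κ * g 1) * den
      ≡⟨ cong₂ (λ s t → s * t * den) (ι-fraction (H μ) (H μ⁺) {{H≢0 μ⁺}}) (sym scale≡) ⟩
    h * scale a * den             ≡⟨ cross-multiplied ⟩
    g 1 * (h⁺ * num)              ≡⟨ *-assoc (g 1) h⁺ num ⟨
    g 1 * h⁺ * num                ∎)
    where
    r = H-ratio μ μ⁺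
    h⁺≢0 : h⁺ ≢ 0ℚ
    h⁺≢0 eq = ℕ.≢-nonZero⁻¹ (H μ⁺) {{H≢0 μ⁺}} (ι-injective (trans eq (sym ι-0)))

  instance
    den-nonZero : NonZero den
    den-nonZero = ≢-nonZero den≢0

  ratio-append : a ≡ 0 → H-ratio μ μ⁺ ≡ num ÷ den
  ratio-append refl =
    ÷-unique {r = H-ratio μ μ⁺} (trans (cong (_* den) (sym (*-identityˡ (H-ratio μ μ⁺)))) (ratio {1ℚ} refl))

  ratio-replace : a ≢ 0 → H-ratio μ μ⁺ ≡ ½ * (num ÷ den)
  ratio-replace a≢0 = begin
    r               ≡⟨ solve 1 (λ r → r := con ½ :* (con 2ℚ :* r)) refl r ⟩
    ½ * (2ℚ * r)    ≡⟨ cong (½ *_) (÷-unique {r = 2ℚ * r} (ratio {2ℚ} (scale-suc a≢0))) ⟩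
    ½ * (num ÷ den) ∎
    where r = H-ratio μ μ⁺

theorem3p1 :
    ∀ (μ : StrictPartition) {m : ℕ} (corners : Vec Box m) → IsOuterCorners μ corners →
    ∀ (i : Fin (suc m)) (μ⁺ : StrictPartition) (□ : Box) →
    IsAddition μ □ μ⁺ → content □ ≡ x μ corners i →
    let X : Fin (suc m) → ℚ
        X j = binom₂ (x μ corners j)
        Y : Fin m → ℚ
        Y j = binom₂ (y corners j)
        num : ℚ
        num = ∏ (λ j → X i - Y j)
        den₀ : ℚ
        den₀ = ∏ (λ (j : Fin m) → X i - X (suc j))
        den : ℚ
        den = ∏ (removeAt (λ j → X i - X j) i)
    in (i ≡ zero → Σ[ nz ∈ NonZero den₀ ] H-ratio μ μ⁺ ≡ (num ÷ den₀) {{nz}})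
     × (1 ≤ toℕ i → Σ[ nz ∈ NonZero den ] H-ratio μ μ⁺ ≡ ½ * (num ÷ den) {{nz}})
theorem3p1 μ corners isC zero μ⁺ □ add content≡ =
  -- x₀ = 1 forces a = 0. Removing index zero leaves the indices `suc j`, so `den₀` agrees with
  -- `den` by computation.
  (λ _ → den-nonZero , ratio-append (ℕ.suc-injective (trans (sym xᵢ≡) x₀≡1))) , λ ()
  where
  growth = addition⇒grow {μ} {μ⁺} {□} add
  xᵢ≡ = trans (sym content≡) (proj₂ (proj₂ growth))
  x₀≡1 = x-zero μ (outerCorners⇒scan μ isC)
  open HookRatio μ corners isC zero μ⁺ (proj₁ (proj₂ growth)) xᵢ≡
theorem3p1 μ corners isC (suc i) μ⁺ □ add content≡ =
  -- If a were 0, then xᵢ = 1 = x₀, contradicting distinctness.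
  (λ ()) , λ _ → den-nonZero , ratio-replace λ a≡0 →
    contradiction (x-injective μ s (trans (x-zero μ s) (sym (trans xᵢ≡ (cong suc a≡0))))) λ ()
  where
  growth = addition⇒grow {μ} {μ⁺} {□} add
  xᵢ≡ = trans (sym content≡) (proj₂ (proj₂ growth))
  s = outerCorners⇒scan μ isC
  open HookRatio μ corners isC (suc i) μ⁺ (proj₁ (proj₂ growth)) xᵢ≡
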